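{- Let $A(n,k)$ denote the Eulerian numbers. Then $$\sum_{n\ge0}A(2n,n+1)z^n=14+3\left(3z^2-4z+2\right)\Psi(z)+\left(21z^3+20z^2+13z+23\right)\Psi^3(z)+3\left(6z^4+4z^3+3z^2+4\right)\Psi^5(z)\quad\text{modulo }27.$$
   Context: $A(n,k)$ is the number of permutations of $\{1,\dots,n\}$ with exactly $k-1$ descents; equivalently $A(n,k)=\sum_{j=0}^{k}(-1)^{k-j}\binom{n+1}{k-j}j^n$ (with $A(0,1)=1$). $\Psi(z)=\prod_{j\ge0}(1+z^{3^j})$. "Modulo $27$" means all coefficients of the difference of the two power series in $z$ are divisible by $27$. -}

module Defs where

open import Data.Bool.Base using (if_then_else_)
open import Data.Fin.Base using (toℕ)
open import Data.Fin.Properties using (toℕ<n)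
open import Data.Integer.Base as ℤ using (ℤ; +_; 0ℤ; 1ℤ)
import Data.Integer.Divisibility as ℤ
import Data.Integer.Properties as ℤ
open import Data.List.Base
  using (List; []; _∷_; [_]; _++_; map; concatMap; filter; length; applyDownFrom)
open import Data.List.Membership.Propositional using (_∈_; _∉_; lose; find)
open import Data.List.Membership.Propositional.Properties
  using (∈-map⁺; ∈-map⁻; ∈-∃++; ∈-concatMap⁺; ∈-concatMap⁻; ∈-applyDownFrom⁻)
open import Data.List.Relation.Binary.Permutation.Propositional
  using (_↭_; ↭-refl; ↭-sym; ↭-trans; prep; swap)
open import Data.List.Relation.Binary.Permutation.Propositional.Properties
  using (∈-resp-↭; drop-mid; ↭-empty-inv)
open import Data.List.Relation.Unary.All as All using (All; []; _∷_)
import Data.List.Relation.Unary.All.Properties as All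
open import Data.List.Relation.Unary.AllPairs as AllPairs using (AllPairs; []; _∷_)
import Data.List.Relation.Unary.AllPairs.Properties as AllPairs
open import Data.List.Relation.Unary.Any using (here; there)
open import Data.List.Relation.Unary.Unique.Propositional using (Unique)
import Data.List.Relation.Unary.Unique.Propositional.Properties as Unique
open import Data.List.Properties using (∷-injectiveˡ; ∷-injectiveʳ)
open import Data.Nat.Base as ℕ using (ℕ; zero; suc; _≤_; _<_; z≤n; s≤s)
open import Data.Nat.Properties as ℕ using (_<?_; _≟_)
open import Data.Product.Base using (_×_; _,_)
open import Function.Bundles using (_⇔_; mk⇔; Equivalence)
open import Relation.Nullary using (¬_; does; contradiction)
open import Relation.Nullary.Decidable using (dec-false)
open import Relation.Binary.PropositionalEquality
  using (_≡_; _≢_; refl; sym; trans; cong; cong₂; subst; module ≡-Reasoning)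

open import Algebra.Properties.Semiring.Sum ℤ.+-*-semiring
  using (sum⁺-syntax; sum-cong-≗; sum-replicate-zero)

module _ {X : Set} where

  insertions : X → List X → List (List X)
  insertions x []       = [ [ x ] ]
  insertions x (y ∷ ys) = (x ∷ y ∷ ys) ∷ map (y ∷_) (insertions x ys)

-- Permutations of {1,…,n} in one-line notation.  The lemmas
-- ∈-permutations and permutations-unique below show that every
-- rearrangement of 1,…,n is listed, exactly once, and nothing else.

permutations : ℕ → List (List ℕ)
permutations zero    = [ [] ]
permutations (suc n) = concatMap (insertions (suc n)) (permutations n)

descents : List ℕ → ℕ
descents []           = 0
descents (x ∷ [])     = 0
descents (x ∷ y ∷ xs) = (if does (y <? x) then 1 else 0) ℕ.+ descents (y ∷ xs)

-- "Exactly k − 1 descents" is written suc (descents π) ≡ k, so that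
-- A n 0 = 0 (no truncated subtraction) and A 0 1 = 1.

A : ℕ → ℕ → ℕ
A n k = length (filter (λ π → suc (descents π) ≟ k) (permutations n))

module _ {X : Set} where

  ∈-insertions⁻ : ∀ (x : X) xs {p} → p ∈ insertions x xs → p ↭ x ∷ xs
  ∈-insertions⁻ x []       (here refl) = ↭-refl
  ∈-insertions⁻ x (y ∷ ys) (here refl) = ↭-refl
  ∈-insertions⁻ x (y ∷ ys) (there p∈) with ∈-map⁻ (y ∷_) p∈
  ... | q , q∈ , refl =
    ↭-trans (prep y (∈-insertions⁻ x ys q∈)) (swap y x ↭-refl)

  ∈-insertions⁺ : ∀ (x : X) ys zs → ys ++ x ∷ zs ∈ insertions x (ys ++ zs)
  ∈-insertions⁺ x []       []       = here refl
  ∈-insertions⁺ x []       (z ∷ zs) = here refl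
  ∈-insertions⁺ x (y ∷ ys) zs       = there (∈-map⁺ (y ∷_) (∈-insertions⁺ x ys zs))

  insertions-unique : ∀ (x : X) xs → x ∉ xs → Unique (insertions x xs)
  insertions-unique x []       x∉ = [] ∷ []
  insertions-unique x (y ∷ ys) x∉ =
    All.tabulate head≢ ∷
    Unique.map⁺ ∷-injectiveʳ (insertions-unique x ys (λ i → x∉ (there i)))
    where
    head≢ : ∀ {q} → q ∈ map (y ∷_) (insertions x ys) → x ∷ y ∷ ys ≢ q
    head≢ q∈ eq with ∈-map⁻ (y ∷_) q∈
    ... | _ , _ , refl = x∉ (here (∷-injectiveˡ eq))

  insertions-injective : ∀ (x : X) xs ys {p} → x ∉ xs → x ∉ ys →
                         p ∈ insertions x xs → p ∈ insertions x ys → xs ≡ ys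
  insertions-injective x []       []       _ _ _ _ = refl
  insertions-injective x []       (b ∷ bs) _ y∉ (here refl) (there q) with ∈-map⁻ (b ∷_) q
  ... | _ , _ , refl = contradiction (here refl) y∉
  insertions-injective x (a ∷ as) []       x∉ _ (there p) (here refl) with ∈-map⁻ (a ∷_) p
  ... | _ , _ , refl = contradiction (here refl) x∉
  insertions-injective x (a ∷ as) (b ∷ bs) _ _ (here refl) (here eq) = ∷-injectiveʳ eq
  insertions-injective x (a ∷ as) (b ∷ bs) _ y∉ (here refl) (there q) with ∈-map⁻ (b ∷_) q
  ... | _ , _ , refl = contradiction (here refl) y∉
  insertions-injective x (a ∷ as) (b ∷ bs) x∉ _ (there p) (here refl) with ∈-map⁻ (a ∷_) p
  ... | _ , _ , refl = contradiction (here refl) x∉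
  insertions-injective x (a ∷ as) (b ∷ bs) x∉ y∉ (there p) (there q)
    with ∈-map⁻ (a ∷_) p | ∈-map⁻ (b ∷_) q
  ... | _ , p′ , refl | _ , q′ , refl =
    cong (a ∷_) (insertions-injective x as bs (λ i → x∉ (there i)) (λ i → y∉ (there i)) p′ q′)

-- applyDownFrom suc n is n ∷ … ∷ 1 ∷ [].

∈-permutations : ∀ n {π} → (π ∈ permutations n) ⇔ (π ↭ applyDownFrom suc n)
∈-permutations n = mk⇔ (sound n) (complete n)
  where
  sound : ∀ n {π} → π ∈ permutations n → π ↭ applyDownFrom suc n
  sound zero    (here refl) = ↭-refl
  sound (suc n) π∈ with find (∈-concatMap⁻ (insertions (suc n)) {xs = permutations n} π∈)
  ... | σ , σ∈ , π∈σ = ↭-trans (∈-insertions⁻ (suc n) σ π∈σ) (prep _ (sound n σ∈))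

  complete : ∀ n {π} → π ↭ applyDownFrom suc n → π ∈ permutations n
  complete zero    π↭ = here (↭-empty-inv π↭)
  complete (suc n) π↭ with ∈-∃++ (∈-resp-↭ (↭-sym π↭) (here refl))
  ... | ys , zs , refl = ∈-concatMap⁺ (insertions (suc n))
    (lose (complete n (drop-mid ys [] π↭)) (∈-insertions⁺ (suc n) ys zs))

permutations-fresh : ∀ n {π} → π ∈ permutations n → suc n ∉ π
permutations-fresh n π∈ n∈
  with ∈-applyDownFrom⁻ suc (∈-resp-↭ (Equivalence.to (∈-permutations n) π∈) n∈)
... | _ , i<n , refl = ℕ.<-irrefl refl i<n

permutations-unique : ∀ n → Unique (permutations n)
permutations-unique zero    = [] ∷ []
permutations-unique (suc n) = Unique.concat⁺
  (All.map⁺ (All.tabulate λ {σ} σ∈ → insertions-unique (suc n) σ (permutations-fresh n σ∈)))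
  (AllPairs.map⁺ (disjoint (permutations n) (permutations-fresh n) (permutations-unique n)))
  where
  disjoint : ∀ σs → (∀ {σ} → σ ∈ σs → suc n ∉ σ) → Unique σs →
             AllPairs (λ σ τ → ∀ {p} → ¬ (p ∈ insertions (suc n) σ × p ∈ insertions (suc n) τ)) σs
  disjoint []       fr []       = []
  disjoint (σ ∷ σs) fr (σ≢ ∷ u) =
    All.tabulate (λ {τ} τ∈ (p , q) → All.lookup σ≢ τ∈
      (insertions-injective (suc n) σ τ (fr (here refl)) (fr (there τ∈)) p q)) ∷
    disjoint σs (λ i → fr (there i)) u

ℤ⟦z⟧ : Set
ℤ⟦z⟧ = ℕ → ℤ

infixl 6 _+_ _-_
infixl 7 _*_
infixr 8 _^_
infix  4 _≡_[mod_]

_+_ _-_ _*_ : ℤ⟦z⟧ → ℤ⟦z⟧ → ℤ⟦z⟧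
(f + g) n = f n ℤ.+ g n
(f - g) n = f n ℤ.- g n
(f * g) n = ∑[ i ≤ n ] (f (toℕ i) ℤ.* g (n ℕ.∸ toℕ i))

const : ℕ → ℤ⟦z⟧
const c zero    = + c
const c (suc _) = 0ℤ

monomial : ℕ → ℤ⟦z⟧
monomial k n = if does (n ≟ k) then 1ℤ else 0ℤ

z : ℤ⟦z⟧
z = monomial 1

_^_ : ℤ⟦z⟧ → ℕ → ℤ⟦z⟧
f ^ zero  = const 1
f ^ suc k = f * f ^ k

_≡_[mod_] : ℤ⟦z⟧ → ℤ⟦z⟧ → ℕ → Set
f ≡ g [mod m ] = ∀ n → + m ℤ.∣ (f - g) n

partialΨ : ℕ → ℤ⟦z⟧
partialΨ zero    = const 1
partialΨ (suc N) = (const 1 + monomial (3 ℕ.^ N)) * partialΨ N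

-- The coefficient of zⁿ is the same in all partial products with at
-- least n factors (see Ψ-limit), so the diagonal is the z-adic limit.

Ψ : ℤ⟦z⟧
Ψ n = partialΨ n n

private

  n<3^n : ∀ n → n < 3 ℕ.^ n
  n<3^n zero    = s≤s z≤n
  n<3^n (suc n) = begin-strict
    suc n                        ≤⟨ n<3^n n ⟩
    3 ℕ.^ n                      <⟨ ℕ.m<m+n (3 ℕ.^ n) (ℕ.≤-trans (ℕ.m^n>0 3 n) (ℕ.m≤m+n _ _)) ⟩
    3 ℕ.^ suc n                  ∎
    where open ℕ.≤-Reasoning

  monomial-≢ : ∀ {k n} → n ≢ k → monomial k n ≡ 0ℤ
  monomial-≢ {k} {n} n≢k = cong (if_then 1ℤ else 0ℤ) (dec-false (n ≟ k) n≢k)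

  [1+z^k]*-low : ∀ {k n} (f : ℤ⟦z⟧) → n < k → ((const 1 + monomial k) * f) n ≡ f n
  [1+z^k]*-low {k} {n} f n<k = begin
    ((const 1 + monomial k) * f) n                       ≡⟨⟩
    (1ℤ ℤ.+ monomial k 0) ℤ.* f n ℤ.+ _                ≡⟨ cong₂ ℤ._+_ (cong (λ c → (1ℤ ℤ.+ c) ℤ.* f n) (monomial-≢ 0≢k)) tail≡0 ⟩
    1ℤ ℤ.* f n ℤ.+ 0ℤ                              ≡⟨ ℤ.+-identityʳ _ ⟩
    1ℤ ℤ.* f n                                     ≡⟨ ℤ.*-identityˡ (f n) ⟩
    f n                                            ∎
    where
    open ≡-Reasoning
    0≢k : 0 ≢ k
    0≢k 0≡k = ℕ.n≮0 (subst (n <_) (sym 0≡k) n<k)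
    tail≡0 = trans
      (sum-cong-≗ {n} λ i → cong (λ c → (0ℤ ℤ.+ c) ℤ.* f (n ℕ.∸ suc (toℕ i)))
        (monomial-≢ (ℕ.<⇒≢ (ℕ.≤-<-trans (toℕ<n i) n<k))))
      (sum-replicate-zero n)

Ψ-limit : ∀ {n N} → n ≤ N → partialΨ N n ≡ Ψ n
Ψ-limit n≤N = go (ℕ.≤⇒≤′ n≤N)
  where
  go : ∀ {n N} → n ℕ.≤′ N → partialΨ N n ≡ Ψ n
  go ℕ.≤′-refl = refl
  go {n} {suc N} (ℕ.≤′-step n≤′N) = trans
    ([1+z^k]*-low (partialΨ N) (ℕ.≤-<-trans (ℕ.≤′⇒≤ n≤′N) (n<3^n N)))
    (go n≤′N)

{-# OPTIONS --safe #-}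
module Submission where

-- Let Eₙ be the n-th Eulerian polynomial, θ = x d/dx and q = 1 − x.  The
-- insertion of a maximum gives Eₙ₊₁ = qθEₙ + (n+1)xEₙ.  Two such steps map
-- the span of the x^(i+1) q^(2j) (1+x) to itself, so that E₂ₙ₊₂ is a
-- combination of these with i + j = n, whose coefficients vanish modulo 27
-- for i ≥ 4.  The coefficient of x^(n+2) in such a term is (−1)ʲ times the
-- j-th Catalan number, so the generating function is, modulo 27, a
-- combination of h, θh and θ²h, where 1 + 2h = √(1+4z).  Finally
-- Ψ² ≡ 1/(1+z) modulo 3, because (1+z)(1+z)² ≡ 1+z³, and so on; therefore
-- Ψ √(1+4z) = 1 + 3r, and expanding in powers of 3 expresses √(1+4z) and
-- its inverse in terms of Ψ modulo 27.

open import Algebra.Bundles using (CommutativeRing)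
import Algebra.Solver.Ring
open import Algebra.Solver.Ring.AlmostCommutativeRing using (fromCommutativeRing; _-Raw-AlmostCommutative⟶_)
open import Algebra.Structures using (IsCommutativeRing)
open import Data.Bool.Base using (Bool; true; false; if_then_else_)
open import Data.Integer.Base as ℤ using (ℤ; +_; -[1+_]; 0ℤ; 1ℤ)
open import Data.Integer.Divisibility.Signed as Signed using (divides)
import Data.Integer.Properties as ℤ
open import Data.Integer.Tactic.RingSolver using (solve-∀)
open import Data.List.Base using (List; []; _∷_; _++_; map; concatMap; filter; length; applyDownFrom)
open import Data.List.Membership.Propositional using (_∈_)
open import Data.List.Membership.Propositional.Properties using (∈-applyDownFrom⁻)
open import Data.List.Properties using (length-applyDownFrom)
open import Data.List.Relation.Binary.Permutation.Propositional.Properties using (∈-resp-↭; ↭-length)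
open import Data.List.Relation.Unary.All as All using (All; []; _∷_)
open import Data.List.Relation.Unary.Any using (here; there)
open import Data.Maybe.Base using (Maybe; just; nothing)
import Data.Nat.Base as ℕ
open import Data.Nat.Base using (ℕ; zero; suc; _≤_; _<_; z≤n; s≤s)
import Data.Nat.Induction as ℕ
import Data.Nat.Properties as ℕ
open import Data.Product.Base using (∃; _,_; proj₁; proj₂)
open import Function.Base using (_∘_)
open import Function.Bundles using (Equivalence)
open import Level using (0ℓ)
import Relation.Binary.PropositionalEquality as ≡
open import Relation.Nullary.Decidable using (does; yes; no; dec-true; dec-false)
open import Relation.Unary using (Decidable)

-- For n ≥ 1, E₂ₙ / q^(2n+1) = Σ k^(2n) xᵏ. After this division each step is θ, and G m = x^m (1+x)
-- / q^(2m+1) satisfies θ² G m = m² G m + (2m+1)(2m+2) G (m+1). The expansion is therefore that of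
-- k^(2n) in central factorials, with all denominators cleared. Its coefficients are `V i j` =
-- (2i+2)!/2 · h_j(1², 2², ..., (i+1)²), h_j being the complete homogeneous symmetric polynomial.
-- The factor (2i+2)!/2 is divisible by 3 for i = 1, by 9 for i = 2 and 3, and by 81 for i ≥ 4. So
-- only four rows survive modulo 27, and in the rows i = 1, 2, 3 the value h_j matters only modulo 9
-- or 3, where it is a polynomial function of j.
--
-- The ring identities are stated for any commutative ring with a map from ℤ, because they are
-- needed for series modulo 3, modulo 27 and modulo 0, the last being exact equality.

module ℤ-Algebra
  (R : CommutativeRing 0ℓ 0ℓ)
  (morphism : ℤ.+-*-rawRing -Raw-AlmostCommutative⟶ fromCommutativeRing R)
  where

  open CommutativeRing R
  open _-Raw-AlmostCommutative⟶_ morphism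
    renaming (⟦_⟧ to ι; +-homo to ι-+; *-homo to ι-*; 0-homo to ι-0; 1-homo to ι-1)
  open import Algebra.Properties.Semiring.Exp semiring public using () renaming (_^_ to _^ᴿ_)
  open import Relation.Binary.Reasoning.Setoid setoid

  private
    _≟_ : ∀ a b → Maybe (ι a ≈ ι b)
    a ≟ b with a ℤ.≟ b
    ... | yes a≡b = just (reflexive (≡.cong ι a≡b))
    ... | no  _   = nothing

  open Algebra.Solver.Ring ℤ.+-*-rawRing (fromCommutativeRing R) morphism _≟_
    using (solve; _:=_; _:+_; _:*_; _:-_; :-_; _:^_; con)

  +-multiple : ∀ {c} → ι c ≈ 0# → ∀ a k → a + ι c * k ≈ a
  +-multiple ι-c≈0 a k = trans (+-congˡ (trans (*-congʳ ι-c≈0) (zeroˡ k))) (+-identityʳ a)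

  -- Derivations, the Eulerian step operator and the Catalan equation.

  module Derivation
    (θ : Carrier → Carrier)
    (θ-cong : ∀ {f g} → f ≈ g → θ f ≈ θ g)
    (θ-+ : ∀ f g → θ (f + g) ≈ θ f + θ g)
    (θ-* : ∀ f g → θ (f * g) ≈ θ f * g + f * θ g)
    (θ-ι : ∀ c → θ (ι c) ≈ 0#)
    (x : Carrier) (θ-x : θ x ≈ x)
    where

    q : Carrier
    q = ι (+ 1) - x

    θ-neg : ∀ f → θ (- f) ≈ - θ f
    θ-neg f = begin
      θ (- f)                     ≈⟨ solve 2 (λ a b → a := a :+ b :- b) refl (θ (- f)) (θ f) ⟩
      θ (- f) + θ f - θ f         ≈⟨ +-congʳ (θ-+ (- f) f) ⟨
      θ (- f + f) - θ f           ≈⟨ +-congʳ (θ-cong (trans (-‿inverseˡ f) (sym ι-0))) ⟩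
      θ (ι 0ℤ) - θ f              ≈⟨ +-congʳ (θ-ι 0ℤ) ⟩
      0# - θ f                    ≈⟨ +-identityˡ (- θ f) ⟩
      - θ f                       ∎

    θ-scale : ∀ c f → θ (ι c * f) ≈ ι c * θ f
    θ-scale c f = begin
      θ (ι c * f)                ≈⟨ θ-* (ι c) f ⟩
      θ (ι c) * f + ι c * θ f    ≈⟨ +-congʳ (trans (*-congʳ (θ-ι c)) (zeroˡ f)) ⟩
      0# + ι c * θ f             ≈⟨ +-identityˡ _ ⟩
      ι c * θ f                  ∎

    θ-x² : θ (x * x) ≈ ι (+ 2) * (x * x)
    θ-x² = trans (θ-* x x) (trans (+-cong (*-congʳ θ-x) (*-congˡ θ-x))
             (solve 1 (λ x → x :* x :+ x :* x := con (+ 2) :* (x :* x)) refl x))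

    θ-q : θ q ≈ - x
    θ-q = begin
      θ (ι (+ 1) - x)         ≈⟨ θ-+ (ι (+ 1)) (- x) ⟩
      θ (ι (+ 1)) + θ (- x)   ≈⟨ +-cong (θ-ι (+ 1)) (trans (θ-neg x) (-‿cong θ-x)) ⟩
      0# - x                  ≈⟨ +-identityˡ (- x) ⟩
      - x                     ∎

    ι-sucʳ : ∀ n → ι (+ suc n) ≈ ι (+ 1) + ι (+ n)
    ι-sucʳ n = ι-+ (+ 1) (+ n)

    θ-x^ : ∀ k → θ (x ^ᴿ k) ≈ ι (+ k) * x ^ᴿ k
    θ-x^ zero    = begin
      θ 1#            ≈⟨ θ-cong ι-1 ⟨
      θ (ι (+ 1))     ≈⟨ θ-ι (+ 1) ⟩
      0#              ≈⟨ trans (*-congʳ ι-0) (zeroˡ 1#) ⟨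
      ι (+ 0) * 1#    ∎
    θ-x^ (suc k) = begin
      θ (x * x ^ᴿ k)                            ≈⟨ θ-* x (x ^ᴿ k) ⟩
      θ x * x ^ᴿ k + x * θ (x ^ᴿ k)              ≈⟨ +-cong (*-congʳ θ-x) (*-congˡ (θ-x^ k)) ⟩
      x * x ^ᴿ k + x * (ι (+ k) * x ^ᴿ k)        ≈⟨ solve 3 (λ x y k → x :* y :+ x :* (k :* y) := (con (+ 1) :+ k) :* (x :* y)) refl x (x ^ᴿ k) (ι (+ k)) ⟩
      (ι (+ 1) + ι (+ k)) * (x * x ^ᴿ k)        ≈⟨ *-congʳ (ι-sucʳ k) ⟨
      ι (+ suc k) * (x * x ^ᴿ k)                ∎

    -- The extra factor `q` absorbs the predecessor in θ qᵏ = -k x q^(k-1), so k = 0 fits the same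
    -- formula.
    q*θ-q^ : ∀ k → q * θ (q ^ᴿ k) ≈ - (ι (+ k) * x * q ^ᴿ k)
    q*θ-q^ zero    = begin
      q * θ 1#                  ≈⟨ *-congˡ (trans (θ-cong (sym ι-1)) (trans (θ-ι (+ 1)) (sym ι-0))) ⟩
      q * ι (+ 0)               ≈⟨ solve 3 (λ q x y → q :* con (+ 0) := :- (con (+ 0) :* x :* y)) refl q x 1# ⟩
      - (ι (+ 0) * x * 1#)      ∎
    q*θ-q^ (suc k) = begin
      q * θ (q * q ^ᴿ k)                          ≈⟨ *-congˡ (θ-* q (q ^ᴿ k)) ⟩
      q * (θ q * q ^ᴿ k + q * θ (q ^ᴿ k))          ≈⟨ *-congˡ (+-cong (*-congʳ θ-q) (q*θ-q^ k)) ⟩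
      q * (- x * q ^ᴿ k + - (ι (+ k) * x * q ^ᴿ k))
        ≈⟨ solve 4 (λ q x y k → q :* (:- x :* y :+ :- (k :* x :* y)) := :- ((con (+ 1) :+ k) :* x :* (q :* y))) refl q x (q ^ᴿ k) (ι (+ k)) ⟩
      - ((ι (+ 1) + ι (+ k)) * x * (q * q ^ᴿ k))  ≈⟨ -‿cong (*-congʳ (*-congʳ (ι-sucʳ k))) ⟨
      - (ι (+ suc k) * x * (q * q ^ᴿ k))          ∎

    q*θ-x^q^ : ∀ m n → q * θ (x ^ᴿ m * q ^ᴿ n) ≈ (ι (+ m) * q - ι (+ n) * x) * (x ^ᴿ m * q ^ᴿ n)
    q*θ-x^q^ m n = begin
      q * θ (x ^ᴿ m * q ^ᴿ n)
        ≈⟨ *-congˡ (θ-* (x ^ᴿ m) (q ^ᴿ n)) ⟩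
      q * (θ (x ^ᴿ m) * q ^ᴿ n + x ^ᴿ m * θ (q ^ᴿ n))
        ≈⟨ solve 5 (λ q X′ Q X Q′ → q :* (X′ :* Q :+ X :* Q′) := q :* X′ :* Q :+ X :* (q :* Q′)) refl q (θ (x ^ᴿ m)) (q ^ᴿ n) (x ^ᴿ m) (θ (q ^ᴿ n)) ⟩
      q * θ (x ^ᴿ m) * q ^ᴿ n + x ^ᴿ m * (q * θ (q ^ᴿ n))
        ≈⟨ +-cong (*-congʳ (*-congˡ (θ-x^ m))) (*-congˡ (q*θ-q^ n)) ⟩
      q * (ι (+ m) * x ^ᴿ m) * q ^ᴿ n + x ^ᴿ m * - (ι (+ n) * x * q ^ᴿ n)
        ≈⟨ solve 6 (λ q M X Q N x → q :* (M :* X) :* Q :+ X :* :- (N :* x :* Q) := (M :* q :- N :* x) :* (X :* Q)) refl q (ι (+ m)) (x ^ᴿ m) (q ^ᴿ n) (ι (+ n)) x ⟩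
      (ι (+ m) * q - ι (+ n) * x) * (x ^ᴿ m * q ^ᴿ n) ∎

    -- For c = n + 1 and θ = x d/dx this takes the n-th Eulerian polynomial
    -- to the next one.

    step : Carrier → Carrier → Carrier
    step c f = q * θ f + c * x * f

    -- Here `k` is q times the logarithmic derivative of `F`; knowing it lets `F` be pulled out of
    -- the step without dividing by `F`.
    step-product : ∀ {F k} c u → q * θ F ≈ k * F → step c (F * u) ≈ F * ((k + c * x) * u + q * θ u)
    step-product {F} {k} c u qθF = begin
      q * θ (F * u) + c * x * (F * u)
        ≈⟨ +-congʳ (*-congˡ (θ-* F u)) ⟩
      q * (θ F * u + F * θ u) + c * x * (F * u)
        ≈⟨ solve 6 (λ q F′ F u u′ cx → q :* (F′ :* u :+ F :* u′) :+ cx :* (F :* u)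
                       := (q :* F′) :* u :+ F :* (q :* u′ :+ cx :* u)) refl q (θ F) F u (θ u) (c * x) ⟩
      (q * θ F) * u + F * (q * θ u + c * x * u)
        ≈⟨ +-congʳ (*-congʳ qθF) ⟩
      (k * F) * u + F * (q * θ u + c * x * u)
        ≈⟨ solve 6 (λ k F u u′ cx q → k :* F :* u :+ F :* (q :* u′ :+ cx :* u)
                       := F :* ((k :+ cx) :* u :+ q :* u′)) refl k F u (θ u) (c * x) q ⟩
      F * ((k + c * x) * u + q * θ u) ∎

    step-cong : ∀ {c c′ f f′} → c ≈ c′ → f ≈ f′ → step c f ≈ step c′ f′
    step-cong c≈ f≈ = +-cong (*-congˡ (θ-cong f≈)) (*-cong (*-congʳ c≈) f≈)

    step-+ : ∀ c f g → step c (f + g) ≈ step c f + step c g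
    step-+ c f g = begin
      q * θ (f + g) + c * x * (f + g)      ≈⟨ +-congʳ (*-congˡ (θ-+ f g)) ⟩
      q * (θ f + θ g) + c * x * (f + g)
        ≈⟨ solve 6 (λ q f′ g′ d f g → q :* (f′ :+ g′) :+ d :* (f :+ g) := (q :* f′ :+ d :* f) :+ (q :* g′ :+ d :* g)) refl q (θ f) (θ g) (c * x) f g ⟩
      step c f + step c g                  ∎

    step-scale : ∀ c a f → step c (ι a * f) ≈ ι a * step c f
    step-scale c a f = begin
      q * θ (ι a * f) + c * x * (ι a * f)      ≈⟨ +-congʳ (*-congˡ (θ-scale a f)) ⟩
      q * (ι a * θ f) + c * x * (ι a * f)
        ≈⟨ solve 5 (λ q a f′ d f → q :* (a :* f′) :+ d :* (a :* f) := a :* (q :* f′ :+ d :* f)) refl q (ι a) (θ f) (c * x) f ⟩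
      ι a * step c f                           ∎

    module _ (m n : ℕ) where

      private
        M = ι (+ m)
        N = ι (+ n)
        F = x ^ᴿ m * q ^ᴿ n
        u₁ = M + (ι (+ 2) * M + ι (+ 2)) * x + M * (x * x)

        θ-1+x : θ (ι (+ 1) + x) ≈ x
        θ-1+x = trans (θ-+ (ι (+ 1)) x) (trans (+-cong (θ-ι (+ 1)) θ-x) (+-identityˡ x))

        b = + 2 ℤ.* + m ℤ.+ + 2

        ι-b : ι b ≈ ι (+ 2) * M + ι (+ 2)
        ι-b = trans (ι-+ (+ 2 ℤ.* + m) (+ 2)) (+-congʳ (ι-* (+ 2) (+ m)))

        θ-u₁ : θ u₁ ≈ (ι (+ 2) * M + ι (+ 2)) * x + M * (ι (+ 2) * (x * x))
        θ-u₁ = begin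
          θ u₁
            ≈⟨ trans (θ-+ _ _) (+-congʳ (θ-+ _ _)) ⟩
          θ M + θ ((ι (+ 2) * M + ι (+ 2)) * x) + θ (M * (x * x))
            ≈⟨ +-cong (+-cong (θ-ι (+ m)) (trans (θ-cong (*-congʳ (sym ι-b))) (trans (θ-scale b x) (*-cong ι-b θ-x))))
                      (trans (θ-scale (+ m) (x * x)) (*-congˡ θ-x²)) ⟩
          0# + (ι (+ 2) * M + ι (+ 2)) * x + M * (ι (+ 2) * (x * x))
            ≈⟨ +-congʳ (+-identityˡ _) ⟩
          (ι (+ 2) * M + ι (+ 2)) * x + M * (ι (+ 2) * (x * x)) ∎

      -- With c = 2M + N + 1 the exponent N drops out of the first step, whose cofactor becomes
      -- M(1+x)² + 2x; the second step brings back the single factor 1 + x. Up to powers of q this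
      -- is the action of θ² on x^m (1+x) / q^(2m+1).
      double-step :
        step (ι (+ 2) * M + N + ι (+ 2)) (step (ι (+ 2) * M + N + ι (+ 1)) (x ^ᴿ m * q ^ᴿ n * (ι (+ 1) + x)))
          ≈ M * M * (x ^ᴿ m * (q * (q * q ^ᴿ n)) * (ι (+ 1) + x))
            + (ι (+ 2) * M + ι (+ 1)) * (ι (+ 2) * M + ι (+ 2)) * (x * x ^ᴿ m * q ^ᴿ n * (ι (+ 1) + x))
      double-step = begin
        step c₂ (step c₁ (F * (ι (+ 1) + x)))
          ≈⟨ step-cong refl (step-product c₁ (ι (+ 1) + x) (q*θ-x^q^ m n)) ⟩
        step c₂ (F * ((M * q - N * x + c₁ * x) * (ι (+ 1) + x) + q * θ (ι (+ 1) + x)))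
          ≈⟨ step-cong refl (*-congˡ (+-congˡ (*-congˡ θ-1+x))) ⟩
        step c₂ (F * ((M * q - N * x + c₁ * x) * (ι (+ 1) + x) + q * x))
          ≈⟨ step-cong refl (*-congˡ (solve 3 (λ M N x →
               let q = con (+ 1) :- x in
               (M :* q :- N :* x :+ (con (+ 2) :* M :+ N :+ con (+ 1)) :* x) :* (con (+ 1) :+ x) :+ q :* x
               := M :+ (con (+ 2) :* M :+ con (+ 2)) :* x :+ M :* (x :* x)) refl M N x)) ⟩
        step c₂ (F * u₁)
          ≈⟨ step-product c₂ u₁ (q*θ-x^q^ m n) ⟩
        F * ((M * q - N * x + c₂ * x) * u₁ + q * θ u₁)
          ≈⟨ *-congˡ (+-congˡ (*-congˡ θ-u₁)) ⟩
        F * ((M * q - N * x + c₂ * x) * u₁ + q * ((ι (+ 2) * M + ι (+ 2)) * x + M * (ι (+ 2) * (x * x))))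
          ≈⟨ solve 5 (λ M N x X Q →
               let q = con (+ 1) :- x in
               X :* Q :* ((M :* q :- N :* x :+ (con (+ 2) :* M :+ N :+ con (+ 2)) :* x)
                            :* (M :+ (con (+ 2) :* M :+ con (+ 2)) :* x :+ M :* (x :* x))
                          :+ q :* ((con (+ 2) :* M :+ con (+ 2)) :* x :+ M :* (con (+ 2) :* (x :* x))))
               := M :* M :* (X :* (q :* (q :* Q)) :* (con (+ 1) :+ x))
                  :+ (con (+ 2) :* M :+ con (+ 1)) :* (con (+ 2) :* M :+ con (+ 2)) :* (x :* X :* Q :* (con (+ 1) :+ x)))
               refl M N x (x ^ᴿ m) (q ^ᴿ n) ⟩
        M * M * (x ^ᴿ m * (q * (q * q ^ᴿ n)) * (ι (+ 1) + x))
          + (ι (+ 2) * M + ι (+ 1)) * (ι (+ 2) * M + ι (+ 2)) * (x * x ^ᴿ m * q ^ᴿ n * (ι (+ 1) + x)) ∎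
        where
        c₁ = ι (+ 2) * M + N + ι (+ 1)
        c₂ = ι (+ 2) * M + N + ι (+ 2)

    θ-q^suc : ∀ n → θ (q ^ᴿ suc n) ≈ - (ι (+ suc n) * x * q ^ᴿ n)
    θ-q^suc n = begin
      θ (q * q ^ᴿ n)                          ≈⟨ θ-* q (q ^ᴿ n) ⟩
      θ q * q ^ᴿ n + q * θ (q ^ᴿ n)            ≈⟨ +-cong (*-congʳ θ-q) (q*θ-q^ n) ⟩
      - x * q ^ᴿ n + - (ι (+ n) * x * q ^ᴿ n)
        ≈⟨ solve 3 (λ x Q N → :- x :* Q :+ :- (N :* x :* Q) := :- ((con (+ 1) :+ N) :* x :* Q)) refl x (q ^ᴿ n) (ι (+ n)) ⟩
      - ((ι (+ 1) + ι (+ n)) * x * q ^ᴿ n)    ≈⟨ -‿cong (*-congʳ (*-congʳ (ι-sucʳ n))) ⟨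
      - (ι (+ suc n) * x * q ^ᴿ n)            ∎

    module _ (k n : ℕ) (n≡2k : ι (+ n) ≈ ι (+ 2) * ι (+ k)) where

      private
        K = ι (+ k)
        Q = q ^ᴿ n
        b = + 2 ℤ.* + k ℤ.+ + 1
        c = + k ℤ.+ + 2
        -- A telescoping certificate: the quadratic for which (k + 2 - θ)(q^(n+1) w) is the
        -- recurrence combination. The factor k + 1 in `ballot` keeps its coefficients integral.
        w = K + ι (+ 1) + (ι (+ 2) * K + ι (+ 1)) * x + (K + ι (+ 2)) * (x * x)

        ι-b : ι b ≈ ι (+ 2) * K + ι (+ 1)
        ι-b = trans (ι-+ (+ 2 ℤ.* + k) (+ 1)) (+-congʳ (ι-* (+ 2) (+ k)))

        ι-c : ι c ≈ K + ι (+ 2)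
        ι-c = ι-+ (+ k) (+ 2)

        θ-w : θ w ≈ (ι (+ 2) * K + ι (+ 1)) * x + (K + ι (+ 2)) * (ι (+ 2) * (x * x))
        θ-w = begin
          θ w
            ≈⟨ trans (θ-+ _ _) (+-congʳ (trans (θ-+ _ _) (+-congʳ (θ-+ _ _)))) ⟩
          θ K + θ (ι (+ 1)) + θ ((ι (+ 2) * K + ι (+ 1)) * x) + θ ((K + ι (+ 2)) * (x * x))
            ≈⟨ +-cong (+-cong (trans (+-cong (θ-ι (+ k)) (θ-ι (+ 1))) (+-identityˡ 0#))
                 (trans (θ-cong (*-congʳ (sym ι-b))) (trans (θ-scale b x) (*-cong ι-b θ-x))))
                 (trans (θ-cong (*-congʳ (sym ι-c))) (trans (θ-scale c (x * x)) (*-cong ι-c θ-x²))) ⟩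
          0# + (ι (+ 2) * K + ι (+ 1)) * x + (K + ι (+ 2)) * (ι (+ 2) * (x * x))
            ≈⟨ +-congʳ (+-identityˡ _) ⟩
          (ι (+ 2) * K + ι (+ 1)) * x + (K + ι (+ 2)) * (ι (+ 2) * (x * x)) ∎

        ι-suc-n : ι (+ suc n) ≈ ι (+ 2) * K + ι (+ 1)
        ι-suc-n = trans (ι-sucʳ n) (trans (+-comm _ _) (+-congʳ n≡2k))

      -- For θ = x d/dx the coefficient of x^(k+2) on the right vanishes;
      -- on the left it is the three-term recurrence of the Catalan numbers.

      ballot : (K + ι (+ 1)) * ((K + ι (+ 2)) * (q * (q * q ^ᴿ n) * (ι (+ 1) + x))
                                + (ι (+ 4) * K + ι (+ 2)) * (x * (q ^ᴿ n * (ι (+ 1) + x))))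
               ≈ (K + ι (+ 2)) * (q ^ᴿ suc n * w) - θ (q ^ᴿ suc n * w)
      ballot = begin
        (K + ι (+ 1)) * ((K + ι (+ 2)) * (q * (q * Q) * (ι (+ 1) + x))
                                + (ι (+ 4) * K + ι (+ 2)) * (x * (Q * (ι (+ 1) + x))))
          ≈⟨ solve 3 (λ K x Q →
               let q = con (+ 1) :- x
                   w = K :+ con (+ 1) :+ (con (+ 2) :* K :+ con (+ 1)) :* x :+ (K :+ con (+ 2)) :* (x :* x) in
               (K :+ con (+ 1)) :* ((K :+ con (+ 2)) :* (q :* (q :* Q) :* (con (+ 1) :+ x))
                                :+ (con (+ 4) :* K :+ con (+ 2)) :* (x :* (Q :* (con (+ 1) :+ x))))
               := (K :+ con (+ 2)) :* (q :* Q :* w)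
                  :- (:- ((con (+ 2) :* K :+ con (+ 1)) :* x :* Q) :* w
                      :+ q :* Q :* ((con (+ 2) :* K :+ con (+ 1)) :* x :+ (K :+ con (+ 2)) :* (con (+ 2) :* (x :* x)))))
               refl K x Q ⟩
        (K + ι (+ 2)) * (q * Q * w)
          - (- ((ι (+ 2) * K + ι (+ 1)) * x * Q) * w
             + q * Q * ((ι (+ 2) * K + ι (+ 1)) * x + (K + ι (+ 2)) * (ι (+ 2) * (x * x))))
          ≈⟨ +-congˡ (-‿cong (+-cong (*-congʳ (-‿cong (*-congʳ (*-congʳ ι-suc-n)))) (*-congˡ θ-w))) ⟨
        (K + ι (+ 2)) * (q * Q * w) - (- (ι (+ suc n) * x * Q) * w + q * Q * θ w)
          ≈⟨ +-congˡ (-‿cong (trans (θ-* (q * Q) w) (+-congʳ (*-congʳ (θ-q^suc n))))) ⟨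
        (K + ι (+ 2)) * (q * Q * w) - θ (q * Q * w) ∎

    module _ (h : Carrier) where

      private
        D = ι (+ 1) + ι (+ 2) * h

        θ-h+h² : θ (h + h * h) ≈ D * θ h
        θ-h+h² = trans (θ-+ h (h * h)) (trans (+-congˡ (θ-* h h))
          (solve 2 (λ h g → g :+ (g :* h :+ h :* g) := (con (+ 1) :+ con (+ 2) :* h) :* g) refl h (θ h)))

      -- The linear equation for `h` makes the defect h + h² - x solve a homogeneous linear
      -- equation, so that the defect vanishes as soon as its constant term does.
      catalan-ode : (ι (+ 1) + ι (+ 4) * x) * θ h ≈ x * D →
                    (ι (+ 1) + ι (+ 4) * x) * θ (h + h * h - x) ≈ ι (+ 4) * (x * (h + h * h - x))
      catalan-ode ode = begin
        E * θ (h + h * h - x)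
          ≈⟨ *-congˡ (trans (θ-+ _ _) (+-cong θ-h+h² (trans (θ-neg x) (-‿cong θ-x)))) ⟩
        E * (D * θ h - x)
          ≈⟨ solve 4 (λ E D g x → E :* (D :* g :- x) := D :* (E :* g) :- E :* x) refl E D (θ h) x ⟩
        D * (E * θ h) - E * x
          ≈⟨ +-congʳ (*-congˡ ode) ⟩
        D * (x * D) - E * x
          ≈⟨ solve 2 (λ h x → let D = con (+ 1) :+ con (+ 2) :* h in
               D :* (x :* D) :- (con (+ 1) :+ con (+ 4) :* x) :* x
               := con (+ 4) :* (x :* (h :+ h :* h :- x))) refl h x ⟩
        ι (+ 4) * (x * (h + h * h - x)) ∎
        where E = ι (+ 1) + ι (+ 4) * x

      module _ (h+h²≈x : h + h * h ≈ x) where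

        D*θh : D * θ h ≈ x
        D*θh = trans (sym θ-h+h²) (trans (θ-cong h+h²≈x) θ-x)

        D*θθh : D * θ (θ h) ≈ x - ι (+ 2) * (θ h * θ h)
        D*θθh = begin
          D * θ (θ h)
            ≈⟨ solve 3 (λ D g g′ → D :* g′ := con (+ 2) :* g :* g :+ D :* g′ :- con (+ 2) :* (g :* g)) refl D (θ h) (θ (θ h)) ⟩
          ι (+ 2) * θ h * θ h + D * θ (θ h) - ι (+ 2) * (θ h * θ h)
            ≈⟨ +-congʳ (+-congʳ (*-congʳ (trans (θ-+ _ _) (trans (+-cong (θ-ι (+ 1)) (θ-scale (+ 2) h)) (+-identityˡ _))))) ⟨
          θ D * θ h + D * θ (θ h) - ι (+ 2) * (θ h * θ h)
            ≈⟨ +-congʳ (θ-* D (θ h)) ⟨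
          θ (D * θ h) - ι (+ 2) * (θ h * θ h)
            ≈⟨ +-congʳ (trans (θ-cong D*θh) θ-x) ⟩
          x - ι (+ 2) * (θ h * θ h) ∎

  -- Expansion of √(1+4x) and its inverse in powers of 3.

  module Modulo27 (ι-27 : ι (+ 27) ≈ 0#) where

    module _ {x h g g′ p r : Carrier}
      (h+h²≈x : h + h * h ≈ x)
      (D*g≈x : (ι (+ 1) + ι (+ 2) * h) * g ≈ x)
      (D*g′≈ : (ι (+ 1) + ι (+ 2) * h) * g′ ≈ x - ι (+ 2) * (g * g))
      (p*D≈ : p * (ι (+ 1) + ι (+ 2) * h) ≈ ι (+ 1) + ι (+ 3) * r)
      where

      -- D is a square root of E = 1 + 4x, and y inverts it modulo 27.  All
      -- terms are brought to the common factor Y = y⁵, which leaves an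
      -- identity between polynomials in x and r modulo 27.

      private
        D E v y Y : Carrier
        D = ι (+ 1) + ι (+ 2) * h
        E = ι (+ 1) + ι (+ 4) * x
        v = ι (+ 1) + ι (+ 3) * r
        y = p * (ι (+ 13) * (v * v) - ι (+ 12))
        Y = y * (y * (y * (y * y)))

        D*D≈E : D * D ≈ E
        D*D≈E = trans (solve 1 (λ h → let D = con (+ 1) :+ con (+ 2) :* h in
          D :* D := con (+ 1) :+ con (+ 4) :* (h :+ h :* h)) refl h) (+-congˡ (*-congˡ h+h²≈x))

        y*D≈1 : y * D ≈ ι (+ 1)
        y*D≈1 = begin
          y * D                                          ≈⟨ solve 3 (λ p t D → p :* t :* D := (p :* D) :* t) refl p (ι (+ 13) * (v * v) - ι (+ 12)) D ⟩
          (p * D) * (ι (+ 13) * (v * v) - ι (+ 12))      ≈⟨ *-congʳ p*D≈ ⟩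
          v * (ι (+ 13) * (v * v) - ι (+ 12))
            -- 13v² - 12 inverts v modulo 27: for v = 1 + 3r it is congruent to 1 - 3r + 9r².
            ≈⟨ solve 1 (λ r → let v = con (+ 1) :+ con (+ 3) :* r in
                 v :* (con (+ 13) :* (v :* v) :- con (+ 12))
                 := con (+ 1) :+ con (+ 27) :* (r :* (con (+ 3) :+ con (+ 13) :* r :* (con (+ 1) :+ r)))) refl r ⟩
          ι (+ 1) + ι (+ 27) * (r * (ι (+ 3) + ι (+ 13) * r * (ι (+ 1) + r)))
            ≈⟨ +-multiple ι-27 _ _ ⟩
          ι (+ 1)                                        ∎

        divide : ∀ {a b} → D * a ≈ b → a ≈ y * b
        divide {a} {b} Da≈b = begin
          a              ≈⟨ solve 1 (λ a → a := con (+ 1) :* a) refl a ⟩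
          ι (+ 1) * a    ≈⟨ *-congʳ y*D≈1 ⟨
          y * D * a      ≈⟨ trans (*-assoc y D a) (*-congˡ Da≈b) ⟩
          y * b          ∎

        yE≈D : y * E ≈ D
        yE≈D = sym (divide D*D≈E)

        y³E≈y : y * (y * (y * E)) ≈ y
        y³E≈y = trans (*-congˡ (trans (*-congˡ yE≈D) y*D≈1))
          (solve 1 (λ y → y :* con (+ 1) := y) refl y)

        YE≈y³ : Y * E ≈ y * (y * y)
        YE≈y³ = trans (solve 2 (λ y E → (y :* (y :* (y :* (y :* y)))) :* E := y :* (y :* (y :* (y :* (y :* E))))) refl y E)
          (*-congˡ (*-congˡ y³E≈y))

        YE²≈y : Y * E * E ≈ y
        YE²≈y = trans (*-congʳ YE≈y³)
          (trans (solve 2 (λ y E → y :* (y :* y) :* E := y :* (y :* (y :* E))) refl y E) y³E≈y)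

        YE³≈D : Y * E * E * E ≈ D
        YE³≈D = trans (*-congʳ YE²≈y) yE≈D

        g≈ : g ≈ Y * E * E * x
        g≈ = trans (divide D*g≈x) (*-congʳ (sym YE²≈y))

        g′≈ : g′ ≈ Y * E * (E * x - ι (+ 2) * (x * x))
        g′≈ = begin
          g′                                         ≈⟨ divide D*g′≈ ⟩
          y * (x - ι (+ 2) * (g * g))                ≈⟨ *-congˡ (+-congˡ (-‿cong (*-congˡ (*-cong (divide D*g≈x) (divide D*g≈x))))) ⟩
          y * (x - ι (+ 2) * ((y * x) * (y * x)))
            ≈⟨ solve 2 (λ y x → y :* (x :- con (+ 2) :* ((y :* x) :* (y :* x))) := y :* x :- y :* (y :* y) :* con (+ 2) :* (x :* x)) refl y x ⟩
          y * x - y * (y * y) * ι (+ 2) * (x * x)    ≈⟨ +-cong (*-congʳ (sym YE²≈y)) (-‿cong (*-congʳ (*-congʳ (sym YE≈y³)))) ⟩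
          Y * E * E * x - Y * E * ι (+ 2) * (x * x)
            ≈⟨ solve 3 (λ Y E x → Y :* E :* E :* x :- Y :* E :* con (+ 2) :* (x :* x) := Y :* E :* (E :* x :- con (+ 2) :* (x :* x))) refl Y E x ⟩
          Y * E * (E * x - ι (+ 2) * (x * x))        ∎

        p≈yv : p ≈ y * v
        p≈yv = divide (trans (*-comm D p) p*D≈)

        p≈ : p ≈ Y * E * E * v
        p≈ = trans p≈yv (*-congʳ (sym YE²≈y))

        p³≈ : p ^ᴿ 3 ≈ Y * E * (ι (+ 1) + ι (+ 9) * r)
        p³≈ = begin
          p ^ᴿ 3
            ≈⟨ *-cong p≈yv (*-cong p≈yv (*-congʳ p≈yv)) ⟩
          (y * v) ^ᴿ 3
            ≈⟨ solve 2 (λ y r → (y :* (con (+ 1) :+ con (+ 3) :* r)) :^ 3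
                 := y :* (y :* y) :* (con (+ 1) :+ con (+ 9) :* r :+ con (+ 27) :* (r :* r :* (con (+ 1) :+ r)))) refl y r ⟩
          y * (y * y) * (ι (+ 1) + ι (+ 9) * r + ι (+ 27) * (r * r * (ι (+ 1) + r)))
            ≈⟨ *-cong (sym YE≈y³) (+-multiple ι-27 _ _) ⟩
          Y * E * (ι (+ 1) + ι (+ 9) * r) ∎

        -- The outer 3 means that v⁵ is needed only modulo 9, where (1 + 3r)⁵ = 1 + 6r.
        3p⁵≈ : ι (+ 3) * p ^ᴿ 5 ≈ Y * (ι (+ 3) + ι (+ 18) * r)
        3p⁵≈ = begin
          ι (+ 3) * p ^ᴿ 5
            ≈⟨ *-congˡ (*-cong p≈yv (*-cong p≈yv (*-cong p≈yv (*-cong p≈yv (*-congʳ p≈yv))))) ⟩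
          ι (+ 3) * (y * v) ^ᴿ 5
            ≈⟨ solve 2 (λ y r → con (+ 3) :* (y :* (con (+ 1) :+ con (+ 3) :* r)) :^ 5
                 := y :* (y :* (y :* (y :* y))) :* (con (+ 3) :+ con (+ 18) :* r :+ con (+ 27)
                      :* (r :+ r :* r :* (con (+ 10) :+ con (+ 30) :* r :+ con (+ 45) :* r :* r :+ con (+ 27) :* r :* r :* r)))) refl y r ⟩
          Y * (ι (+ 3) + ι (+ 18) * r + ι (+ 27)
            * (r + r * r * (ι (+ 10) + ι (+ 30) * r + ι (+ 45) * r * r + ι (+ 27) * r * r * r)))
            ≈⟨ *-congˡ (+-multiple ι-27 _ _) ⟩
          Y * (ι (+ 3) + ι (+ 18) * r) ∎

        a b c : Carrier
        a = ι (+ 3) * x ^ᴿ 2 - ι (+ 4) * x + ι (+ 2)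
        b = ι (+ 21) * x ^ᴿ 3 + ι (+ 20) * x ^ᴿ 2 + ι (+ 13) * x + ι (+ 23)
        c = ι (+ 6) * x ^ᴿ 4 + ι (+ 4) * x ^ᴿ 3 + ι (+ 3) * x ^ᴿ 2 + ι (+ 4)

        -- Y times k is the quotient by 27 of the difference of the two sides.
        k : Carrier
        k = ι (+ 8) * x ^ᴿ 6 + ι (+ 10) * x ^ᴿ 5 - ι (+ 4) * x ^ᴿ 4 + ι (+ 36) * x ^ᴿ 3 + ι (+ 22) * x ^ᴿ 2 + x - ι (+ 1)
          - (ι (+ 48) * x ^ᴿ 4 + ι (+ 23) * x ^ᴿ 3 + ι (+ 27) * x ^ᴿ 2 + ι (+ 39) * x + ι (+ 11)) * r

      -- The left side is the series produced by `z-*-diagonal-V`, with `g` and `g′` for θh and θ²h.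
      sqrt-expansion :
        ι (+ 1) + (h + x * (ι (+ 12) * g + ι (+ 18) * (g′ - g) + x * (ι (+ 9) * g + x * (ι (+ 9) * (g′ + g)))))
          ≈ ι (+ 14)
            + ι (+ 3) * (ι (+ 3) * x ^ᴿ 2 - ι (+ 4) * x + ι (+ 2)) * p
            + (ι (+ 21) * x ^ᴿ 3 + ι (+ 20) * x ^ᴿ 2 + ι (+ 13) * x + ι (+ 23)) * p ^ᴿ 3
            + ι (+ 3) * (ι (+ 6) * x ^ᴿ 4 + ι (+ 4) * x ^ᴿ 3 + ι (+ 3) * x ^ᴿ 2 + ι (+ 4)) * p ^ᴿ 5
      sqrt-expansion = begin
        ι (+ 1) + (h + x * (ι (+ 12) * g + ι (+ 18) * (g′ - g) + x * (ι (+ 9) * g + x * (ι (+ 9) * (g′ + g)))))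
          -- Since 14 is 1/2 modulo 27, adding 27(1 + h) turns 1 + h into 14 + 14 D.
          ≈⟨ +-multiple ι-27 _ _ ⟨
        ι (+ 1) + (h + x * (ι (+ 12) * g + ι (+ 18) * (g′ - g) + x * (ι (+ 9) * g + x * (ι (+ 9) * (g′ + g)))))
          + ι (+ 27) * (ι (+ 1) + h)
          ≈⟨ solve 4 (λ h x g g′ →
               con (+ 1) :+ (h :+ x :* (con (+ 12) :* g :+ con (+ 18) :* (g′ :- g) :+ x :* (con (+ 9) :* g :+ x :* (con (+ 9) :* (g′ :+ g)))))
               :+ con (+ 27) :* (con (+ 1) :+ h)
               := con (+ 14) :+ (con (+ 14) :* (con (+ 1) :+ con (+ 2) :* h)
                  :+ x :* ((con (+ 9) :* (x :* x) :+ con (+ 9) :* x :- con (+ 6)) :* g :+ con (+ 9) :* ((con (+ 2) :+ x :* x) :* g′)))) refl h x g g′ ⟩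
        ι (+ 14) + (ι (+ 14) * D
          + x * ((ι (+ 9) * (x * x) + ι (+ 9) * x - ι (+ 6)) * g + ι (+ 9) * ((ι (+ 2) + x * x) * g′)))
          ≈⟨ +-congˡ (+-cong (*-congˡ (sym YE³≈D)) (*-congˡ (+-cong (*-congˡ g≈) (*-congˡ (*-congˡ g′≈))))) ⟩
        ι (+ 14) + (ι (+ 14) * (Y * E * E * E)
          + x * ((ι (+ 9) * (x * x) + ι (+ 9) * x - ι (+ 6)) * (Y * E * E * x)
            + ι (+ 9) * ((ι (+ 2) + x * x) * (Y * E * (E * x - ι (+ 2) * (x * x))))))
          -- As `r` is unknown, its coefficient 9(aE² + bE + 2c) must vanish modulo 27 by itself. It
          -- does: modulo 3, E = 1 + x, a = 2(1+x), b = -(1+x)² and c = (1+x)³.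
          ≈⟨ solve 3 (λ x r Y →
               let E = con (+ 1) :+ con (+ 4) :* x
                   a = con (+ 3) :* x :^ 2 :- con (+ 4) :* x :+ con (+ 2)
                   b = con (+ 21) :* x :^ 3 :+ con (+ 20) :* x :^ 2 :+ con (+ 13) :* x :+ con (+ 23)
                   c = con (+ 6) :* x :^ 4 :+ con (+ 4) :* x :^ 3 :+ con (+ 3) :* x :^ 2 :+ con (+ 4)
                   k = con (+ 8) :* x :^ 6 :+ con (+ 10) :* x :^ 5 :- con (+ 4) :* x :^ 4 :+ con (+ 36) :* x :^ 3 :+ con (+ 22) :* x :^ 2 :+ x :- con (+ 1)
                       :- (con (+ 48) :* x :^ 4 :+ con (+ 23) :* x :^ 3 :+ con (+ 27) :* x :^ 2 :+ con (+ 39) :* x :+ con (+ 11)) :* r in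
               con (+ 14) :+ (con (+ 14) :* (Y :* E :* E :* E)
                 :+ x :* ((con (+ 9) :* (x :* x) :+ con (+ 9) :* x :- con (+ 6)) :* (Y :* E :* E :* x)
                   :+ con (+ 9) :* ((con (+ 2) :+ x :* x) :* (Y :* E :* (E :* x :- con (+ 2) :* (x :* x))))))
               := con (+ 14) :+ con (+ 3) :* a :* (Y :* E :* E :* (con (+ 1) :+ con (+ 3) :* r))
                 :+ b :* (Y :* E :* (con (+ 1) :+ con (+ 9) :* r))
                 :+ c :* (Y :* (con (+ 3) :+ con (+ 18) :* r)) :+ con (+ 27) :* (k :* Y))
               refl x r Y ⟩
        ι (+ 14) + ι (+ 3) * a * (Y * E * E * v) + b * (Y * E * (ι (+ 1) + ι (+ 9) * r))
          + c * (Y * (ι (+ 3) + ι (+ 18) * r)) + ι (+ 27) * (k * Y)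
          ≈⟨ +-multiple ι-27 _ _ ⟩
        ι (+ 14) + ι (+ 3) * a * (Y * E * E * v) + b * (Y * E * (ι (+ 1) + ι (+ 9) * r))
          + c * (Y * (ι (+ 3) + ι (+ 18) * r))
          ≈⟨ +-cong (+-cong (+-congˡ (*-congˡ p≈)) (*-congˡ p³≈)) (*-congˡ 3p⁵≈) ⟨
        ι (+ 14) + ι (+ 3) * a * p + b * p ^ᴿ 3 + c * (ι (+ 3) * p ^ᴿ 5)
          ≈⟨ +-congˡ (trans (sym (*-assoc c (ι (+ 3)) (p ^ᴿ 5))) (*-congʳ (*-comm c (ι (+ 3))))) ⟩
        ι (+ 14) + ι (+ 3) * a * p + b * p ^ᴿ 3 + ι (+ 3) * c * p ^ᴿ 5 ∎

  -- Square roots of 1/(1+x) modulo 3.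

  module Modulo3 (ι-3 : ι (+ 3) ≈ 0#) where

    -- This adjoins one factor of the product: `a` stands for z^(3^N), and (1+a)²(1+a) is 1 + a³
    -- modulo 3.
    telescope : ∀ {x a p} → (ι (+ 1) + x) * (p * p) ≈ ι (+ 1) + a →
                (ι (+ 1) + x) * ((ι (+ 1) + a) * p * ((ι (+ 1) + a) * p)) ≈ ι (+ 1) + a * (a * a)
    telescope {x} {a} {p} eq = begin
      (ι (+ 1) + x) * ((ι (+ 1) + a) * p * ((ι (+ 1) + a) * p))
        ≈⟨ solve 3 (λ x a p → let b = con (+ 1) :+ a in
             (con (+ 1) :+ x) :* (b :* p :* (b :* p)) := b :* b :* ((con (+ 1) :+ x) :* (p :* p))) refl x a p ⟩
      (ι (+ 1) + a) * (ι (+ 1) + a) * ((ι (+ 1) + x) * (p * p))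
        ≈⟨ *-congˡ eq ⟩
      (ι (+ 1) + a) * (ι (+ 1) + a) * (ι (+ 1) + a)
        ≈⟨ solve 1 (λ a → let b = con (+ 1) :+ a in
             b :* b :* b := con (+ 1) :+ a :* (a :* a) :+ con (+ 3) :* (a :* b)) refl a ⟩
      ι (+ 1) + a * (a * a) + ι (+ 3) * (a * (ι (+ 1) + a))
        ≈⟨ +-multiple ι-3 _ _ ⟩
      ι (+ 1) + a * (a * a) ∎

    -- D² = 1 + 4x is 1 + x modulo 3, so (pD)² is 1. The difference of squares stays factored
    -- because the sign of the root is settled later by a constant term, in `Ψ-inverts-D`.
    square-factorization : ∀ {x h p} (let D = ι (+ 1) + ι (+ 2) * h) →
      h + h * h ≈ x → (ι (+ 1) + x) * (p * p) ≈ ι (+ 1) →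
      (p * D + ι (+ 1)) * (p * D - ι (+ 1)) ≈ 0#
    square-factorization {x} {h} {p} h+h²≈x eq = begin
      (p * D + ι (+ 1)) * (p * D - ι (+ 1))
        ≈⟨ solve 2 (λ h p → let D = con (+ 1) :+ con (+ 2) :* h; x = h :+ h :* h in
             (p :* D :+ con (+ 1)) :* (p :* D :- con (+ 1))
             := (con (+ 1) :+ x) :* (p :* p) :- con (+ 1) :+ con (+ 3) :* (x :* (p :* p))) refl h p ⟩
      (ι (+ 1) + (h + h * h)) * (p * p) - ι (+ 1) + ι (+ 3) * ((h + h * h) * (p * p))
        ≈⟨ +-multiple ι-3 _ _ ⟩
      (ι (+ 1) + (h + h * h)) * (p * p) - ι (+ 1)
        ≈⟨ +-congʳ (trans (*-congʳ (+-congˡ h+h²≈x)) eq) ⟩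
      ι (+ 1) - ι (+ 1)
        ≈⟨ -‿inverseʳ (ι (+ 1)) ⟩
      0# ∎
      where D = ι (+ 1) + ι (+ 2) * h

open import Defs
open import Relation.Binary.PropositionalEquality
  using (_≡_; _≢_; _≗_; refl; sym; trans; cong; cong₂; subst; module ≡-Reasoning)

-- The commutative ring of integer power series modulo m.

infix  8 neg_
infixl 7 _•_
infix  4 _≋_[mod_]

neg_ : ℤ⟦z⟧ → ℤ⟦z⟧
(neg f) n = ℤ.- f n

_•_ : ℤ → ℤ⟦z⟧ → ℤ⟦z⟧
(c • f) n = c ℤ.* f n

tail : ℤ⟦z⟧ → ℤ⟦z⟧
tail f n = f (suc n)

-- By computation `(f * g) (suc n)` is `f 0 ℤ.* g (suc n) ℤ.+ (tail f * g) n`, and the empty sum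
-- leaves `+ 0ℤ` at degree 0. The product laws therefore go by induction on the degree, passing to
-- the tail of the left factor.
*-cong-≗ : ∀ {f f′ g g′} → f ≗ f′ → g ≗ g′ → f * g ≗ f′ * g′
*-cong-≗ f≗ g≗ zero    = cong₂ (λ a b → a ℤ.* b ℤ.+ 0ℤ) (f≗ 0) (g≗ 0)
*-cong-≗ f≗ g≗ (suc n) =
  cong₂ ℤ._+_ (cong₂ ℤ._*_ (f≗ 0) (g≗ (suc n))) (*-cong-≗ (λ k → f≗ (suc k)) g≗ n)

const-0 : ∀ n → const 0 n ≡ 0ℤ
const-0 zero    = refl
const-0 (suc _) = refl

*-zeroˡ : ∀ {f} g → (∀ n → f n ≡ 0ℤ) → ∀ n → (f * g) n ≡ 0ℤ
*-zeroˡ g f≡0 zero    = cong (λ a → a ℤ.* g 0 ℤ.+ 0ℤ) (f≡0 0)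
*-zeroˡ g f≡0 (suc n) =
  cong₂ (λ a t → a ℤ.* g (suc n) ℤ.+ t) (f≡0 0) (*-zeroˡ g (λ k → f≡0 (suc k)) n)

*-distribʳ : ∀ h f g → (f + g) * h ≗ f * h + g * h
*-distribʳ h f g zero    = lemma (f 0) (g 0) (h 0)
  where
  lemma : ∀ a b c → (a ℤ.+ b) ℤ.* c ℤ.+ 0ℤ ≡ (a ℤ.* c ℤ.+ 0ℤ) ℤ.+ (b ℤ.* c ℤ.+ 0ℤ)
  lemma = solve-∀
*-distribʳ h f g (suc n) =
  trans (cong (λ t → (f 0 ℤ.+ g 0) ℤ.* h (suc n) ℤ.+ t) (*-distribʳ h (tail f) (tail g) n))
    (lemma (f 0) (g 0) (h (suc n)) _ _)
  where
  lemma : ∀ a b c u v → (a ℤ.+ b) ℤ.* c ℤ.+ (u ℤ.+ v) ≡ (a ℤ.* c ℤ.+ u) ℤ.+ (b ℤ.* c ℤ.+ v)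
  lemma = solve-∀

•-* : ∀ c f g → (c • f) * g ≗ c • (f * g)
•-* c f g zero    = lemma c (f 0) (g 0)
  where
  lemma : ∀ a b c → a ℤ.* b ℤ.* c ℤ.+ 0ℤ ≡ a ℤ.* (b ℤ.* c ℤ.+ 0ℤ)
  lemma = solve-∀
•-* c f g (suc n) =
  trans (cong (λ t → c ℤ.* f 0 ℤ.* g (suc n) ℤ.+ t) (•-* c (tail f) g n)) (lemma c (f 0) (g (suc n)) _)
  where
  lemma : ∀ a b c t → a ℤ.* b ℤ.* c ℤ.+ a ℤ.* t ≡ a ℤ.* (b ℤ.* c ℤ.+ t)
  lemma = solve-∀

-- The convolution peels only its left factor by computation; this peels the right one, which is
-- what commutativity needs.
*-tailʳ : ∀ f g n → (f * g) (suc n) ≡ (f * tail g) n ℤ.+ f (suc n) ℤ.* g 0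
*-tailʳ f g zero    = lemma (f 0) (g 1) (f 1) (g 0)
  where
  lemma : ∀ a b c d → a ℤ.* b ℤ.+ (c ℤ.* d ℤ.+ 0ℤ) ≡ a ℤ.* b ℤ.+ 0ℤ ℤ.+ c ℤ.* d
  lemma = solve-∀
*-tailʳ f g (suc n) =
  trans (cong (λ t → f 0 ℤ.* g (suc (suc n)) ℤ.+ t) (*-tailʳ (tail f) g n))
    (sym (ℤ.+-assoc (f 0 ℤ.* g (suc (suc n))) _ _))

*-comm : ∀ f g → f * g ≗ g * f
*-comm f g zero    = cong (ℤ._+ 0ℤ) (ℤ.*-comm (f 0) (g 0))
*-comm f g (suc n) = begin
  f 0 ℤ.* g (suc n) ℤ.+ (tail f * g) n  ≡⟨ cong₂ ℤ._+_ (ℤ.*-comm (f 0) (g (suc n))) (*-comm (tail f) g n) ⟩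
  g (suc n) ℤ.* f 0 ℤ.+ (g * tail f) n  ≡⟨ ℤ.+-comm (g (suc n) ℤ.* f 0) _ ⟩
  (g * tail f) n ℤ.+ g (suc n) ℤ.* f 0  ≡⟨ *-tailʳ g f n ⟨
  (g * f) (suc n)                       ∎
  where open ≡-Reasoning

*-assoc : ∀ f g h → (f * g) * h ≗ f * (g * h)
*-assoc f g h zero    = lemma (f 0) (g 0) (h 0)
  where
  lemma : ∀ a b c → (a ℤ.* b ℤ.+ 0ℤ) ℤ.* c ℤ.+ 0ℤ ≡ a ℤ.* (b ℤ.* c ℤ.+ 0ℤ) ℤ.+ 0ℤ
  lemma = solve-∀
*-assoc f g h (suc n) = begin
  (f * g) 0 ℤ.* h (suc n) ℤ.+ (tail (f * g) * h) n
    ≡⟨⟩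
  (f * g) 0 ℤ.* h (suc n) ℤ.+ (((f 0 • tail g) + tail f * g) * h) n
    ≡⟨ cong (λ t → (f * g) 0 ℤ.* h (suc n) ℤ.+ t) (*-distribʳ h (f 0 • tail g) (tail f * g) n) ⟩
  (f * g) 0 ℤ.* h (suc n) ℤ.+ (((f 0 • tail g) * h) n ℤ.+ (tail f * g * h) n)
    ≡⟨ cong (λ t → (f * g) 0 ℤ.* h (suc n) ℤ.+ t) (cong₂ ℤ._+_ (•-* (f 0) (tail g) h n) (*-assoc (tail f) g h n)) ⟩
  (f 0 ℤ.* g 0 ℤ.+ 0ℤ) ℤ.* h (suc n) ℤ.+ (f 0 ℤ.* (tail g * h) n ℤ.+ (tail f * (g * h)) n)
    ≡⟨ lemma (f 0) (g 0) (h (suc n)) _ _ ⟩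
  f 0 ℤ.* (g * h) (suc n) ℤ.+ (tail f * (g * h)) n
    ∎
  where
  open ≡-Reasoning
  lemma : ∀ a b c u v → (a ℤ.* b ℤ.+ 0ℤ) ℤ.* c ℤ.+ (a ℤ.* u ℤ.+ v) ≡ a ℤ.* (b ℤ.* c ℤ.+ u) ℤ.+ v
  lemma = solve-∀

-- On nonnegative integers this is `const` by computation, so the constants of the ring solver are
-- literally those of the theorem.
ι : ℤ → ℤ⟦z⟧
ι (+ n)    = const n
ι -[1+ n ] = neg const (suc n)

ι-zero : ∀ c → ι c 0 ≡ c
ι-zero (+ n)    = refl
ι-zero -[1+ n ] = refl

ι-suc : ∀ c n → ι c (suc n) ≡ 0ℤ
ι-suc (+ _)    n = refl
ι-suc -[1+ _ ] n = refl

ι-* : ∀ c f → ι c * f ≗ c • f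
ι-* c f zero    = trans (ℤ.+-identityʳ _) (cong (ℤ._* f 0) (ι-zero c))
ι-* c f (suc n) =
  trans (cong₂ ℤ._+_ (cong (ℤ._* f (suc n)) (ι-zero c)) (*-zeroˡ f (ι-suc c) n)) (ℤ.+-identityʳ _)

const-* : ∀ c f → const c * f ≗ (+ c) • f
const-* c = ι-* (+ c)

ι-+-homo : ∀ c d → ι (c ℤ.+ d) ≗ ι c + ι d
ι-+-homo c d zero    = trans (ι-zero (c ℤ.+ d)) (sym (cong₂ ℤ._+_ (ι-zero c) (ι-zero d)))
ι-+-homo c d (suc n) = trans (ι-suc (c ℤ.+ d) n) (sym (cong₂ ℤ._+_ (ι-suc c n) (ι-suc d n)))

ι-*-homo : ∀ c d → ι (c ℤ.* d) ≗ ι c * ι d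
ι-*-homo c d zero    =
  trans (ι-zero (c ℤ.* d)) (sym (trans (ι-* c (ι d) 0) (cong (c ℤ.*_) (ι-zero d))))
ι-*-homo c d (suc n) =
  trans (ι-suc (c ℤ.* d) n) (sym (trans (ι-* c (ι d) (suc n)) (trans (cong (c ℤ.*_) (ι-suc d n)) (ℤ.*-zeroʳ c))))

ι-neg-homo : ∀ c → ι (ℤ.- c) ≗ neg ι c
ι-neg-homo c zero    = trans (ι-zero (ℤ.- c)) (cong ℤ.-_ (sym (ι-zero c)))
ι-neg-homo c (suc n) = trans (ι-suc (ℤ.- c) n) (cong ℤ.-_ (sym (ι-suc c n)))

-- A record rather than the underlying function type, so that the two
-- series can be inferred from a proof.

record _≋_[mod_] (f g : ℤ⟦z⟧) (m : ℕ) : Set where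
  constructor coefficientwise
  field at : ∀ n → + m Signed.∣ f n ℤ.- g n

open _≋_[mod_] public

module _ (m : ℕ) where

  private
    infix 4 _≈_
    _≈_ : ℤ⟦z⟧ → ℤ⟦z⟧ → Set
    f ≈ g = f ≋ g [mod m ]

  ≗⇒≋ : ∀ {f g} → f ≗ g → f ≈ g
  ≗⇒≋ f≗g = coefficientwise λ n → divides 0ℤ (ℤ.i≡j⇒i-j≡0 (f≗g n))

  private
    ≈-sym : ∀ {f g} → f ≈ g → g ≈ f
    ≈-sym {f} {g} f≈g = coefficientwise λ n →
      subst (+ m Signed.∣_) (lemma (f n) (g n)) (Signed.∣m⇒∣-m (at f≈g n))
      where
      lemma : ∀ a b → ℤ.- (a ℤ.- b) ≡ b ℤ.- a
      lemma = solve-∀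

    ≈-trans : ∀ {f g h} → f ≈ g → g ≈ h → f ≈ h
    ≈-trans {f} {g} {h} p q = coefficientwise λ n →
      subst (+ m Signed.∣_) (lemma (f n) (g n) (h n)) (Signed.∣m∣n⇒∣m+n (at p n) (at q n))
      where
      lemma : ∀ a b c → (a ℤ.- b) ℤ.+ (b ℤ.- c) ≡ a ℤ.- c
      lemma = solve-∀

    +-cong : ∀ {f f′ g g′} → f ≈ f′ → g ≈ g′ → f + g ≈ f′ + g′
    +-cong {f} {f′} {g} {g′} p q = coefficientwise λ n →
      subst (+ m Signed.∣_) (lemma (f n) (f′ n) (g n) (g′ n)) (Signed.∣m∣n⇒∣m+n (at p n) (at q n))
      where
      lemma : ∀ a b c d → (a ℤ.- b) ℤ.+ (c ℤ.- d) ≡ (a ℤ.+ c) ℤ.- (b ℤ.+ d)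
      lemma = solve-∀

    neg-cong : ∀ {f g} → f ≈ g → neg f ≈ neg g
    neg-cong {f} {g} p = coefficientwise λ n →
      subst (+ m Signed.∣_) (lemma (f n) (g n)) (Signed.∣m⇒∣-m (at p n))
      where
      lemma : ∀ a b → ℤ.- (a ℤ.- b) ≡ ℤ.- a ℤ.- ℤ.- b
      lemma = solve-∀

    *-congʳ : ∀ {f f′} g → f ≈ f′ → f * g ≈ f′ * g
    *-congʳ {f} {f′} g p = coefficientwise (go {f} {f′} g (at p))
      where
      go : ∀ {f f′} g → (∀ n → + m Signed.∣ f n ℤ.- f′ n) → ∀ n → + m Signed.∣ (f * g) n ℤ.- (f′ * g) n
      go {f} {f′} g d zero    = subst (+ m Signed.∣_) (lemma (f 0) (f′ 0) (g 0)) (Signed.∣m⇒∣m*n (g 0) (d 0))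
        where
        lemma : ∀ a b c → (a ℤ.- b) ℤ.* c ≡ (a ℤ.* c ℤ.+ 0ℤ) ℤ.- (b ℤ.* c ℤ.+ 0ℤ)
        lemma = solve-∀
      go {f} {f′} g d (suc n) = subst (+ m Signed.∣_) (lemma (f 0) (f′ 0) (g (suc n)) _ _)
        (Signed.∣m∣n⇒∣m+n (Signed.∣m⇒∣m*n (g (suc n)) (d 0)) (go {tail f} {tail f′} g (λ k → d (suc k)) n))
        where
        lemma : ∀ a b c u v → (a ℤ.- b) ℤ.* c ℤ.+ (u ℤ.- v) ≡ (a ℤ.* c ℤ.+ u) ℤ.- (b ℤ.* c ℤ.+ v)
        lemma = solve-∀

    *-cong : ∀ {f f′ g g′} → f ≈ f′ → g ≈ g′ → f * g ≈ f′ * g′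
    *-cong {f} {f′} {g} {g′} p q =
      ≈-trans (*-congʳ g p) (≈-trans (≗⇒≋ {f′ * g} (*-comm f′ g))
        (≈-trans (*-congʳ f′ q) (≗⇒≋ {g′ * f′} (*-comm g′ f′))))

    *-identityˡ : ∀ f → const 1 * f ≗ f
    *-identityˡ f n = trans (const-* 1 f n) (ℤ.*-identityˡ (f n))

  isCommutativeRing : IsCommutativeRing _≈_ _+_ _*_ neg_ (const 0) (const 1)
  isCommutativeRing = record
    { isRing = record
      { +-isAbelianGroup = record
        { isGroup = record
          { isMonoid = record
            { isSemigroup = record
              { isMagma = record
                { isEquivalence = record
                  { refl  = ≗⇒≋ λ _ → refl
                  ; sym   = ≈-sym
                  ; trans = ≈-trans
                  }
                ; ∙-cong = +-cong
                }
              ; assoc = λ f g h → ≗⇒≋ λ n → ℤ.+-assoc (f n) (g n) (h n)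
              }
            ; identity = (λ f → ≗⇒≋ λ n → trans (cong (ℤ._+ f n) (const-0 n)) (ℤ.+-identityˡ (f n)))
                       , (λ f → ≗⇒≋ λ n → trans (cong (λ t → f n ℤ.+ t) (const-0 n)) (ℤ.+-identityʳ (f n)))
            }
          ; inverse = (λ f → ≗⇒≋ λ n → trans (ℤ.+-inverseˡ (f n)) (sym (const-0 n)))
                    , (λ f → ≗⇒≋ λ n → trans (ℤ.+-inverseʳ (f n)) (sym (const-0 n)))
          ; ⁻¹-cong = neg-cong
          }
        ; comm = λ f g → ≗⇒≋ λ n → ℤ.+-comm (f n) (g n)
        }
      ; *-cong     = *-cong
      ; *-assoc    = λ f g h → ≗⇒≋ (*-assoc f g h)
      ; *-identity = (λ f → ≗⇒≋ (*-identityˡ f))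
                   , (λ f → ≗⇒≋ λ n → trans (*-comm f (const 1) n) (*-identityˡ f n))
      ; distrib    = (λ f g h → ≗⇒≋ λ n → trans (*-comm f (g + h) n)
                       (trans (*-distribʳ f g h n) (cong₂ ℤ._+_ (*-comm g f n) (*-comm h f n))))
                   , (λ f g h → ≗⇒≋ (*-distribʳ f g h))
      }
    ; *-comm = λ f g → ≗⇒≋ (*-comm f g)
    }

  ℤ⟦z⟧/ : CommutativeRing 0ℓ 0ℓ
  ℤ⟦z⟧/ = record { isCommutativeRing = isCommutativeRing }

-- Only 0 is divisible by 0, so modulus 0 makes the ring identities available as exact equalities.
≋0⇒≗ : ∀ {f g} → f ≋ g [mod 0 ] → f ≗ g
≋0⇒≗ {f} {g} p n = ℤ.i-j≡0⇒i≡j (f n) (g n) (Signed.0∣⇒≡0 (at p n))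

-- The Euler operator z d/dz and the instances of the ring identities.

θ : ℤ⟦z⟧ → ℤ⟦z⟧
θ f n = + n ℤ.* f n

θ-* : ∀ f g → θ (f * g) ≗ θ f * g + f * θ g
θ-* f g zero    = lemma (f 0) (g 0)
  where
  lemma : ∀ a b → 0ℤ ℤ.* (a ℤ.* b ℤ.+ 0ℤ) ≡ (0ℤ ℤ.* a ℤ.* b ℤ.+ 0ℤ) ℤ.+ (a ℤ.* (0ℤ ℤ.* b) ℤ.+ 0ℤ)
  lemma = solve-∀
θ-* f g (suc n) = begin
  + suc n ℤ.* (f 0 ℤ.* g (suc n) ℤ.+ (tail f * g) n)
    ≡⟨ lemma₁ (+ n) (f 0) (g (suc n)) _ ⟩
  + suc n ℤ.* (f 0 ℤ.* g (suc n)) ℤ.+ (tail f * g) n ℤ.+ + n ℤ.* (tail f * g) n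
    ≡⟨ cong (λ t → + suc n ℤ.* (f 0 ℤ.* g (suc n)) ℤ.+ (tail f * g) n ℤ.+ t) (θ-* (tail f) g n) ⟩
  + suc n ℤ.* (f 0 ℤ.* g (suc n)) ℤ.+ (tail f * g) n ℤ.+ ((θ (tail f) * g) n ℤ.+ (tail f * θ g) n)
    ≡⟨ lemma₂ (+ suc n) (f 0) (g (suc n)) _ _ _ ⟩
  (0ℤ ℤ.* f 0 ℤ.* g (suc n) ℤ.+ ((tail f * g) n ℤ.+ (θ (tail f) * g) n))
    ℤ.+ (f 0 ℤ.* (+ suc n ℤ.* g (suc n)) ℤ.+ (tail f * θ g) n)
    ≡⟨ cong (λ t → (0ℤ ℤ.* f 0 ℤ.* g (suc n) ℤ.+ t) ℤ.+ (f 0 ℤ.* (+ suc n ℤ.* g (suc n)) ℤ.+ (tail f * θ g) n))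
         (trans (*-cong-≗ {g = g} tail-θ (λ _ → refl) n) (*-distribʳ g (tail f) (θ (tail f)) n)) ⟨
  (θ f * g + f * θ g) (suc n) ∎
  where
  open ≡-Reasoning
  lemma₁ : ∀ n a b t → (1ℤ ℤ.+ n) ℤ.* (a ℤ.* b ℤ.+ t) ≡ (1ℤ ℤ.+ n) ℤ.* (a ℤ.* b) ℤ.+ t ℤ.+ n ℤ.* t
  lemma₁ = solve-∀
  lemma₂ : ∀ s a b t u v → s ℤ.* (a ℤ.* b) ℤ.+ t ℤ.+ (u ℤ.+ v)
                           ≡ (0ℤ ℤ.* a ℤ.* b ℤ.+ (t ℤ.+ u)) ℤ.+ (a ℤ.* (s ℤ.* b) ℤ.+ v)
  lemma₂ = solve-∀
  tail-θ : tail (θ f) ≗ tail f + θ (tail f)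
  tail-θ k = ℤ.suc-* (+ k) (f (suc k))

θ-+ : ∀ f g → θ (f + g) ≗ θ f + θ g
θ-+ f g n = ℤ.*-distribˡ-+ (+ n) (f n) (g n)

θ-cong : ∀ {m f g} → f ≋ g [mod m ] → θ f ≋ θ g [mod m ]
θ-cong {m} {f} {g} f≋g = coefficientwise λ n →
  subst (+ m Signed.∣_) (lemma (+ n) (f n) (g n)) (Signed.∣n⇒∣m*n (+ n) (at f≋g n))
  where
  lemma : ∀ c a b → c ℤ.* (a ℤ.- b) ≡ c ℤ.* a ℤ.- c ℤ.* b
  lemma = solve-∀

θ-ι : ∀ c → θ (ι c) ≗ const 0
θ-ι c zero    = refl
θ-ι c (suc n) = trans (cong (+ suc n ℤ.*_) (ι-suc c n)) (ℤ.*-zeroʳ (+ suc n))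

θ-z : θ z ≗ z
θ-z 0             = refl
θ-z 1             = refl
θ-z (suc (suc n)) = ℤ.*-zeroʳ (+ suc (suc n))

module _ {m : ℕ} where
  open CommutativeRing (ℤ⟦z⟧/ m) public
    using () renaming (refl to ≋-refl; sym to ≋-sym; trans to ≋-trans
                      ; +-cong to ≋-+-cong; +-congˡ to ≋-+-congˡ; *-congˡ to ≋-*-congˡ)

ι-morphism : ∀ m → ℤ.+-*-rawRing -Raw-AlmostCommutative⟶ fromCommutativeRing (ℤ⟦z⟧/ m)
ι-morphism m = record
  { ⟦_⟧    = ι
  ; +-homo = λ c d → ≗⇒≋ m (ι-+-homo c d)
  ; *-homo = λ c d → ≗⇒≋ m (ι-*-homo c d)
  ; -‿homo = λ c → ≗⇒≋ m (ι-neg-homo c)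
  ; 0-homo = ≋-refl
  ; 1-homo = ≋-refl
  }

module Modulo (m : ℕ) = ℤ-Algebra (ℤ⟦z⟧/ m) (ι-morphism m)

ι-m≋0 : ∀ m → const m ≋ const 0 [mod m ]
ι-m≋0 m = coefficientwise λ where
  zero    → subst (+ m Signed.∣_) (sym (ℤ.+-identityʳ (+ m))) Signed.∣-refl
  (suc n) → divides 0ℤ refl

open Modulo 0 using (_^ᴿ_)
open Modulo.Derivation 0 θ θ-cong
  (λ f g → ≗⇒≋ 0 (θ-+ f g)) (λ f g → ≗⇒≋ 0 (θ-* f g)) (λ c → ≗⇒≋ 0 (θ-ι c)) z (≗⇒≋ 0 θ-z)
  using (q; step; step-cong; step-+; step-scale; double-step; ballot; catalan-ode; D*θh; D*θθh)

≋0⇒≋ : ∀ {m f g} → f ≋ g [mod 0 ] → f ≋ g [mod m ]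
≋0⇒≋ {m} f≋g = ≗⇒≋ m (≋0⇒≗ f≋g)

∣-*-coefficient : ∀ {m} f {g} n → (∀ {k} → k ≤ n → m Signed.∣ g k) → m Signed.∣ (f * g) n
∣-*-coefficient {m} f {g} zero    d = subst (m Signed.∣_) (sym (ℤ.+-identityʳ _)) (Signed.∣n⇒∣m*n (f 0) (d z≤n))
∣-*-coefficient f {g} (suc n) d =
  Signed.∣m∣n⇒∣m+n (Signed.∣n⇒∣m*n (f 0) (d ℕ.≤-refl)) (∣-*-coefficient (tail f) n (λ k≤n → d (ℕ.m≤n⇒m≤1+n k≤n)))

-- Coefficient n of the product is f 0 · g n plus a combination of lower coefficients of `g`,
-- divisible by induction; `unit` then removes f 0.
*-cancelˡ-∣ : ∀ {m} f {g} → (∀ {a} → m Signed.∣ f 0 ℤ.* a → m Signed.∣ a) →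
              (∀ n → m Signed.∣ (f * g) n) → ∀ n → m Signed.∣ g n
*-cancelˡ-∣ {m} f {g} unit d = ℕ.<-rec _ go
  where
  go : ∀ n → (∀ {k} → k < n → m Signed.∣ g k) → m Signed.∣ g n
  go zero    _  = unit (subst (m Signed.∣_) (ℤ.+-identityʳ _) (d 0))
  go (suc n) ih = unit (Signed.∣m+n∣n⇒∣m (d (suc n)) (∣-*-coefficient (tail f) n (λ k≤n → ih (s≤s k≤n))))

*-cong-≤ : ∀ {f f′ g g′} n → (∀ {k} → k ≤ n → f k ≡ f′ k) → (∀ {k} → k ≤ n → g k ≡ g′ k) →
           (f * g) n ≡ (f′ * g′) n
*-cong-≤ zero    f≡ g≡ = cong₂ (λ a b → a ℤ.* b ℤ.+ 0ℤ) (f≡ z≤n) (g≡ z≤n)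
*-cong-≤ (suc n) f≡ g≡ = cong₂ ℤ._+_ (cong₂ ℤ._*_ (f≡ z≤n) (g≡ ℕ.≤-refl))
  (*-cong-≤ n (λ k≤n → f≡ (s≤s k≤n)) (λ k≤n → g≡ (ℕ.m≤n⇒m≤1+n k≤n)))

-- The congruence (1+z) Ψ² ≡ 1 modulo 3.

monomial-0 : monomial 0 ≗ const 1
monomial-0 zero    = refl
monomial-0 (suc _) = refl

monomial-suc-* : ∀ k f n → (monomial (suc k) * f) (suc n) ≡ (monomial k * f) n
monomial-suc-* k f n = ℤ.+-identityˡ _

monomial-+ : ∀ j k → monomial j * monomial k ≗ monomial (j ℕ.+ k)
monomial-+ zero    k n       = trans (*-cong-≗ {g = monomial k} monomial-0 (λ _ → refl) n)
                                 (trans (const-* 1 (monomial k) n) (ℤ.*-identityˡ _))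
monomial-+ (suc j) k zero    = refl
monomial-+ (suc j) k (suc n) = trans (monomial-suc-* j (monomial k) n) (monomial-+ j k n)

monomial-≢ : ∀ {k n} → n ≢ k → monomial k n ≡ 0ℤ
monomial-≢ {k} {n} n≢k = cong (if_then 1ℤ else 0ℤ) (dec-false (n ℕ.≟ k) n≢k)

n<3^n : ∀ n → n < 3 ℕ.^ n
n<3^n zero    = s≤s z≤n
n<3^n (suc n) = begin-strict
  suc n          ≤⟨ n<3^n n ⟩
  3 ℕ.^ n        <⟨ ℕ.^-monoʳ-< 3 (s≤s (s≤s z≤n)) (ℕ.n<1+n n) ⟩
  3 ℕ.^ suc n    ∎
  where open ℕ.≤-Reasoning

const-1-* : ∀ f → const 1 * f ≗ f
const-1-* f n = trans (const-* 1 f n) (ℤ.*-identityˡ (f n))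

module _ where

  open Modulo.Modulo3 3 (ι-m≋0 3) using (telescope)

  partialΨ-square : ∀ N → (const 1 + z) * (partialΨ N * partialΨ N) ≋ const 1 + monomial (3 ℕ.^ N) [mod 3 ]
  partialΨ-square zero    = ≗⇒≋ 3 λ n →
    trans (*-comm (const 1 + z) (const 1 * const 1) n)
      (trans (*-cong-≗ {const 1 * const 1} {const 1} {const 1 + z} (const-1-* (const 1)) (λ _ → refl) n)
        (const-1-* (const 1 + z) n))
  partialΨ-square (suc N) = ≋-trans (telescope {z} {monomial k} {partialΨ N} (partialΨ-square N)) (≋-+-congˡ {x = const 1} (≗⇒≋ 3 cube))
    where
    k = 3 ℕ.^ N
    cube : monomial k * (monomial k * monomial k) ≗ monomial (3 ℕ.* k)
    cube n = trans (*-cong-≗ {monomial k} (λ _ → refl) (monomial-+ k k) n)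
      (trans (monomial-+ k (k ℕ.+ k) n) (cong (λ j → monomial (k ℕ.+ j) n) (cong (k ℕ.+_) (sym (ℕ.+-identityʳ k)))))

  -- Coefficient n can be computed with `partialΨ n` in place of `Ψ`, and there the error term
  -- z^(3^n) is invisible because n < 3^n.
  Ψ-square : (const 1 + z) * (Ψ * Ψ) ≋ const 1 [mod 3 ]
  Ψ-square = coefficientwise λ n →
    subst (+ 3 Signed.∣_)
      (cong₂ ℤ._-_
        (*-cong-≤ {const 1 + z} n (λ _ → refl) λ {k} k≤n →
          *-cong-≤ k (λ j≤k → Ψ-limit (ℕ.≤-trans j≤k k≤n)) (λ j≤k → Ψ-limit (ℕ.≤-trans j≤k k≤n)))
        (trans (cong (λ a → const 1 n ℤ.+ a) (monomial-≢ (ℕ.<⇒≢ (n<3^n n)))) (ℤ.+-identityʳ _)))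
      (at (partialΨ-square n) n)

-- Signed Catalan numbers and their generating function.

z-*-suc : ∀ f n → (z * f) (suc n) ≡ f n
z-*-suc f n = trans (monomial-suc-* 0 f n)
  (trans (*-cong-≗ {g = f} monomial-0 (λ _ → refl) n) (const-1-* f n))

scalar-* : ∀ {c} a f → c ≋ ι a [mod 0 ] → ∀ n → (c * f) n ≡ a ℤ.* f n
scalar-* a f c≋ n = trans (*-cong-≗ {g = f} (≋0⇒≗ c≋) (λ _ → refl) n) (ι-* a f n)

n*i≡0⇒i≡0 : ∀ n {i} → + suc n ℤ.* i ≡ 0ℤ → i ≡ 0ℤ
n*i≡0⇒i≡0 n {i} eq = ℤ.*-cancelˡ-≡ (+ suc n) i 0ℤ (trans eq (sym (ℤ.*-zeroʳ (+ suc n))))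

-- The k-th Catalan number up to the sign (−1)ᵏ; hence the series h below
-- satisfies h + h² = z.

e : ℕ → ℤ
e k = (q ^ᴿ (k ℕ.* 2) * (const 1 + z)) (suc k)

-- Even exponents are written `k ℕ.* 2` because `suc k ℕ.* 2` computes to two more than `k ℕ.* 2`,
-- which yields two more factors `q` with no rewriting.
ι-k*2 : ∀ k → ι (+ (k ℕ.* 2)) ≋ ι (+ 2) * ι (+ k) [mod 0 ]
ι-k*2 k = ≗⇒≋ 0 λ n → trans (cong (λ i → ι i n) (trans (ℤ.pos-* k 2) (ℤ.*-comm (+ k) (+ 2)))) (ι-*-homo (+ 2) (+ k) n)

-- This is the coefficient of z^(k+2) in `ballot`: the operator k + 2 - θ annihilates it, and the
-- factor k + 1 cancels in ℤ.
e-recurrence : ∀ k → (+ k ℤ.+ + 2) ℤ.* e (suc k) ℤ.+ (+ 4 ℤ.* + k ℤ.+ + 2) ℤ.* e k ≡ 0ℤ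
e-recurrence k = n*i≡0⇒i≡0 k (begin
  + suc k ℤ.* ((+ k ℤ.+ + 2) ℤ.* e (suc k) ℤ.+ (+ 4 ℤ.* + k ℤ.+ + 2) ℤ.* e k)
    ≡⟨ cong₂ (λ a b → a ℤ.* ((+ k ℤ.+ + 2) ℤ.* e (suc k) ℤ.+ b)) (ℤ.+-comm (+ k) 1ℤ) (scaled (k ℕ.* 2)) ⟨
  (+ k ℤ.+ 1ℤ) ℤ.* ((+ k ℤ.+ + 2) ℤ.* e (suc k) ℤ.+ ((ι (+ 4) * ι (+ k) + ι (+ 2)) * (z * (q ^ᴿ (k ℕ.* 2) * (const 1 + z)))) n)
    ≡⟨ cong (λ a → (+ k ℤ.+ 1ℤ) ℤ.* (a ℤ.+ ((ι (+ 4) * ι (+ k) + ι (+ 2)) * (z * (q ^ᴿ (k ℕ.* 2) * (const 1 + z)))) n))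
         (scalar-* (+ k ℤ.+ + 2) (q ^ᴿ (suc k ℕ.* 2) * (const 1 + z)) (ι-+≋ (+ 2)) n) ⟨
  (+ k ℤ.+ 1ℤ) ℤ.* (lhs n)
    ≡⟨ scalar-* (+ k ℤ.+ 1ℤ) lhs (ι-+≋ 1ℤ) n ⟨
  ((ι (+ k) + ι 1ℤ) * lhs) n
    ≡⟨ ≋0⇒≗ (ballot k (k ℕ.* 2) (ι-k*2 k)) n ⟩
  ((ι (+ k) + ι (+ 2)) * g) n ℤ.- + n ℤ.* g n
    ≡⟨ cong (λ a → a ℤ.- + n ℤ.* g n) (scalar-* (+ k ℤ.+ + 2) g (ι-+≋ (+ 2)) n) ⟩
  (+ k ℤ.+ + 2) ℤ.* g n ℤ.- + n ℤ.* g n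
    ≡⟨ cong (λ a → a ℤ.* g n ℤ.- + n ℤ.* g n) (ℤ.+-comm (+ k) (+ 2)) ⟩
  + n ℤ.* g n ℤ.- + n ℤ.* g n
    ≡⟨ ℤ.+-inverseʳ (+ n ℤ.* g n) ⟩
  0ℤ ∎)
  where
  open ≡-Reasoning
  n = suc (suc k)
  lhs g : ℤ⟦z⟧
  lhs = (ι (+ k) + ι (+ 2)) * (q ^ᴿ (suc k ℕ.* 2) * (const 1 + z))
        + (ι (+ 4) * ι (+ k) + ι (+ 2)) * (z * (q ^ᴿ (k ℕ.* 2) * (const 1 + z)))
  g = q ^ᴿ suc (k ℕ.* 2) * (ι (+ k) + ι (+ 1) + (ι (+ 2) * ι (+ k) + ι (+ 1)) * z + (ι (+ k) + ι (+ 2)) * (z * z))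

  ι-+≋ : ∀ b → ι (+ k) + ι b ≋ ι (+ k ℤ.+ b) [mod 0 ]
  ι-+≋ b = ≋-sym (≗⇒≋ 0 (ι-+-homo (+ k) b))

  scaled : ∀ j → ((ι (+ 4) * ι (+ k) + ι (+ 2)) * (z * (q ^ᴿ j * (const 1 + z)))) n
                 ≡ (+ 4 ℤ.* + k ℤ.+ + 2) ℤ.* (q ^ᴿ j * (const 1 + z)) (suc k)
  scaled j = trans
    (scalar-* (+ 4 ℤ.* + k ℤ.+ + 2) (z * (q ^ᴿ j * (const 1 + z)))
      (≗⇒≋ 0 λ i → sym (trans (ι-+-homo (+ 4 ℤ.* + k) (+ 2) i) (cong (λ a → a ℤ.+ ι (+ 2) i) (ι-*-homo (+ 4) (+ k) i)))) n)
    (cong ((+ 4 ℤ.* + k ℤ.+ + 2) ℤ.*_) (z-*-suc (q ^ᴿ j * (const 1 + z)) (suc k)))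

h : ℤ⟦z⟧
h zero    = 0ℤ
h (suc k) = e k

[1+4z]*-suc : ∀ f n → ((ι (+ 1) + ι (+ 4) * z) * f) (suc n) ≡ f (suc n) ℤ.+ + 4 ℤ.* f n
[1+4z]*-suc f n = begin
  ((ι (+ 1) + ι (+ 4) * z) * f) (suc n)                 ≡⟨ *-distribʳ f (ι (+ 1)) (ι (+ 4) * z) (suc n) ⟩
  (ι (+ 1) * f) (suc n) ℤ.+ (ι (+ 4) * z * f) (suc n)   ≡⟨ cong₂ ℤ._+_ (const-1-* f (suc n)) (*-assoc (ι (+ 4)) z f (suc n)) ⟩
  f (suc n) ℤ.+ (ι (+ 4) * (z * f)) (suc n)             ≡⟨ cong (λ a → f (suc n) ℤ.+ a) (const-* 4 (z * f) (suc n)) ⟩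
  f (suc n) ℤ.+ + 4 ℤ.* (z * f) (suc n)                 ≡⟨ cong (λ a → f (suc n) ℤ.+ + 4 ℤ.* a) (z-*-suc f n) ⟩
  f (suc n) ℤ.+ + 4 ℤ.* f n                             ∎
  where open ≡-Reasoning

-- From degree 2 on this is `e-recurrence`, with 4(k+1) split as (4k+2) + 2; degrees 0 and 1 hold by
-- computation.
h-ode : (ι (+ 1) + ι (+ 4) * z) * θ h ≋ z * (ι (+ 1) + ι (+ 2) * h) [mod 0 ]
h-ode = ≗⇒≋ 0 go
  where
  open ≡-Reasoning
  lemma : ∀ k a b → (+ 2 ℤ.+ k) ℤ.* a ℤ.+ + 4 ℤ.* ((+ 1 ℤ.+ k) ℤ.* b)
                    ≡ (k ℤ.+ + 2) ℤ.* a ℤ.+ (+ 4 ℤ.* k ℤ.+ + 2) ℤ.* b ℤ.+ (0ℤ ℤ.+ + 2 ℤ.* b)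
  lemma = solve-∀
  go : (ι (+ 1) + ι (+ 4) * z) * θ h ≗ z * (ι (+ 1) + ι (+ 2) * h)
  go 0 = refl
  go 1 = refl
  go (suc (suc k)) = begin
    ((ι (+ 1) + ι (+ 4) * z) * θ h) (suc (suc k))
      ≡⟨ [1+4z]*-suc (θ h) (suc k) ⟩
    + suc (suc k) ℤ.* e (suc k) ℤ.+ + 4 ℤ.* (+ suc k ℤ.* e k)
      ≡⟨ lemma (+ k) (e (suc k)) (e k) ⟩
    (+ k ℤ.+ + 2) ℤ.* e (suc k) ℤ.+ (+ 4 ℤ.* + k ℤ.+ + 2) ℤ.* e k ℤ.+ (0ℤ ℤ.+ + 2 ℤ.* e k)
      ≡⟨ cong (ℤ._+ (0ℤ ℤ.+ + 2 ℤ.* e k)) (e-recurrence k) ⟩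
    0ℤ ℤ.+ (0ℤ ℤ.+ + 2 ℤ.* e k)
      ≡⟨ ℤ.+-identityˡ _ ⟩
    0ℤ ℤ.+ + 2 ℤ.* e k
      ≡⟨ cong (λ t → 0ℤ ℤ.+ t) (const-* 2 h (suc k)) ⟨
    (ι (+ 1) + ι (+ 2) * h) (suc k)
      ≡⟨ z-*-suc (ι (+ 1) + ι (+ 2) * h) (suc k) ⟨
    (z * (ι (+ 1) + ι (+ 2) * h)) (suc (suc k)) ∎

-- By `catalan-ode` the defect `δ` satisfies (1+4z) θδ = 4zδ. Hence δ n = 0 forces (n+1) δ (n+1) =
-- 0, and the constant term is 0.
h+h²≋z : h + h * h ≋ z [mod 0 ]
h+h²≋z = ≗⇒≋ 0 λ n → ℤ.i-j≡0⇒i≡j ((h + h * h) n) (z n) (δ≡0 n)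
  where
  open ≡-Reasoning
  δ : ℤ⟦z⟧
  δ = h + h * h + neg z
  δ-ode : ∀ n → ((ι (+ 1) + ι (+ 4) * z) * θ δ) n ≡ (ι (+ 4) * (z * δ)) n
  δ-ode = ≋0⇒≗ (catalan-ode h h-ode)
  δ≡0 : ∀ n → δ n ≡ 0ℤ
  δ≡0 zero    = refl
  δ≡0 (suc n) = n*i≡0⇒i≡0 n (begin
    θ δ (suc n)                                     ≡⟨ ℤ.+-identityʳ _ ⟨
    θ δ (suc n) ℤ.+ 0ℤ                              ≡⟨ cong (λ a → θ δ (suc n) ℤ.+ a) (θδ≡0 (+ 4)) ⟨
    θ δ (suc n) ℤ.+ + 4 ℤ.* θ δ n                   ≡⟨ [1+4z]*-suc (θ δ) n ⟨
    ((ι (+ 1) + ι (+ 4) * z) * θ δ) (suc n)         ≡⟨ δ-ode (suc n) ⟩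
    (ι (+ 4) * (z * δ)) (suc n)                     ≡⟨ const-* 4 (z * δ) (suc n) ⟩
    + 4 ℤ.* (z * δ) (suc n)                         ≡⟨ cong (+ 4 ℤ.*_) (trans (z-*-suc δ n) (δ≡0 n)) ⟩
    + 4 ℤ.* 0ℤ                                      ≡⟨⟩
    0ℤ                                              ∎)
    where
    θδ≡0 : ∀ c → c ℤ.* θ δ n ≡ 0ℤ
    θδ≡0 c = trans (cong (λ a → c ℤ.* (+ n ℤ.* a)) (δ≡0 n)) (trans (cong (c ℤ.*_) (ℤ.*-zeroʳ (+ n))) (ℤ.*-zeroʳ c))

quotient-series : ∀ {m f g} → f ≋ g [mod m ] → ∃ λ r → f ≋ g + const m * r [mod 0 ]
quotient-series {m} {f} {g} f≋g = r , ≗⇒≋ 0 λ n → begin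
  f n                            ≡⟨ lemma (f n) (g n) ⟩
  g n ℤ.+ (f n ℤ.- g n)          ≡⟨ cong (λ a → g n ℤ.+ a) (Signed._∣_.equality (at f≋g n)) ⟩
  g n ℤ.+ r n ℤ.* + m            ≡⟨ cong (λ a → g n ℤ.+ a) (trans (const-* m r n) (ℤ.*-comm (+ m) (r n))) ⟨
  g n ℤ.+ (const m * r) n        ∎
  where
  open ≡-Reasoning
  r : ℤ⟦z⟧
  r n = Signed.quotient (at f≋g n)
  lemma : ∀ a b → a ≡ b ℤ.+ (a ℤ.- b)
  lemma = solve-∀

-- The product (ΨD + 1)(ΨD - 1) vanishes modulo 3, and ΨD + 1 has constant term 2, a unit modulo 3,
-- so it can be cancelled.
Ψ-inverts-D : Ψ * (ι (+ 1) + ι (+ 2) * h) ≋ const 1 [mod 3 ]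
Ψ-inverts-D = coefficientwise (*-cancelˡ-∣ (Ψ * D + const 1) {Ψ * D + neg const 1} unit λ n →
  subst (+ 3 Signed.∣_) (trans (cong (λ a → ((Ψ * D + const 1) * (Ψ * D + neg const 1)) n ℤ.- a) (const-0 n)) (ℤ.+-identityʳ _))
    (at (square-factorization {z} {h} {Ψ} (≋0⇒≋ h+h²≋z) Ψ-square) n))
  where
  open Modulo.Modulo3 3 (ι-m≋0 3) using (square-factorization)
  D = ι (+ 1) + ι (+ 2) * h
  unit : ∀ {a} → + 3 Signed.∣ + 2 ℤ.* a → + 3 Signed.∣ a
  unit {a} (divides c eq) = divides (a ℤ.- c) (trans (lemma₁ a) (trans (cong (λ b → a ℤ.* + 3 ℤ.- b) eq) (lemma₂ a c)))
    where
    lemma₁ : ∀ a → a ≡ a ℤ.* + 3 ℤ.- + 2 ℤ.* a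
    lemma₁ = solve-∀
    lemma₂ : ∀ a c → a ℤ.* + 3 ℤ.- c ℤ.* + 3 ≡ (a ℤ.- c) ℤ.* + 3
    lemma₂ = solve-∀

-- The recurrence of the Eulerian numbers by insertion of a maximum.

module _ {X : Set} where

  weight : (X → ℤ) → List X → ℤ
  weight w []       = 0ℤ
  weight w (x ∷ xs) = w x ℤ.+ weight w xs

  weight-++ : ∀ w xs ys → weight w (xs ++ ys) ≡ weight w xs ℤ.+ weight w ys
  weight-++ w []       ys = sym (ℤ.+-identityˡ _)
  weight-++ w (x ∷ xs) ys = trans (cong (λ t → w x ℤ.+ t) (weight-++ w xs ys)) (sym (ℤ.+-assoc (w x) _ _))

  weight-cong : ∀ {v w} xs → (∀ {x} → x ∈ xs → v x ≡ w x) → weight v xs ≡ weight w xs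
  weight-cong []       v≡w = refl
  weight-cong (x ∷ xs) v≡w = cong₂ ℤ._+_ (v≡w (here refl)) (weight-cong xs (v≡w ∘ there))

  weight-linear : ∀ a b (v w : X → ℤ) xs →
    weight (λ x → a ℤ.* v x ℤ.+ b ℤ.* w x) xs ≡ a ℤ.* weight v xs ℤ.+ b ℤ.* weight w xs
  weight-linear a b v w []       = sym (cong₂ ℤ._+_ (ℤ.*-zeroʳ a) (ℤ.*-zeroʳ b))
  weight-linear a b v w (x ∷ xs) =
    trans (cong (λ t → a ℤ.* v x ℤ.+ b ℤ.* w x ℤ.+ t) (weight-linear a b v w xs)) (lemma a b (v x) (w x) _ _)
    where
    lemma : ∀ a b x y s t → a ℤ.* x ℤ.+ b ℤ.* y ℤ.+ (a ℤ.* s ℤ.+ b ℤ.* t) ≡ a ℤ.* (x ℤ.+ s) ℤ.+ b ℤ.* (y ℤ.+ t)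
    lemma = solve-∀

  weight-zero : ∀ {w : X → ℤ} xs → (∀ x → w x ≡ 0ℤ) → weight w xs ≡ 0ℤ
  weight-zero []       w≡0 = refl
  weight-zero (x ∷ xs) w≡0 = cong₂ ℤ._+_ (w≡0 x) (weight-zero xs w≡0)

  length-filter : ∀ {P : X → Set} (P? : Decidable P) xs →
                  + length (filter P? xs) ≡ weight (λ x → if does (P? x) then 1ℤ else 0ℤ) xs
  length-filter P? []       = refl
  length-filter P? (x ∷ xs) with does (P? x)
  ... | true  = cong (λ t → 1ℤ ℤ.+ t) (length-filter P? xs)
  ... | false = trans (length-filter P? xs) (sym (ℤ.+-identityˡ _))

module _ {X Y : Set} where

  weight-map : ∀ (w : Y → ℤ) (f : X → Y) xs → weight w (map f xs) ≡ weight (w ∘ f) xs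
  weight-map w f []       = refl
  weight-map w f (x ∷ xs) = cong (λ t → w (f x) ℤ.+ t) (weight-map w f xs)

  weight-concatMap : ∀ (w : Y → ℤ) (f : X → List Y) xs → weight w (concatMap f xs) ≡ weight (weight w ∘ f) xs
  weight-concatMap w f []       = refl
  weight-concatMap w f (x ∷ xs) = trans (weight-++ w (f x) (concatMap f xs)) (cong (λ t → weight w (f x) ℤ.+ t) (weight-concatMap w f xs))

descents-insert : ∀ {x y} ys → y < x → descents (x ∷ y ∷ ys) ≡ suc (descents (y ∷ ys))
descents-insert {x} {y} ys y<x = cong (λ b → (if b then 1 else 0) ℕ.+ descents (y ∷ ys)) (dec-true (y ℕ.<? x) y<x)

descents-insert-after : ∀ {x y} ys → y < x → descents (y ∷ x ∷ ys) ≡ descents (x ∷ ys)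
descents-insert-after {x} {y} ys y<x =
  cong (λ b → (if b then 1 else 0) ℕ.+ descents (x ∷ ys)) (dec-false (x ℕ.<? y) (ℕ.<-asym y<x))

-- Inserting a new maximum at the end or into a descent keeps the number
-- of descents; in the remaining places it creates one.

weight-insertions-after : ∀ (g : ℕ → ℤ) {x} y ys → All (_< x) (y ∷ ys) → let d = descents (y ∷ ys) in
  weight (λ r → g (descents (y ∷ r))) (insertions x ys)
    ≡ + suc d ℤ.* g d ℤ.+ (+ length ys ℤ.- + d) ℤ.* g (suc d)
weight-insertions-after g y [] (y<x ∷ []) =
  trans (cong (λ d → g d ℤ.+ 0ℤ) (descents-insert-after [] y<x)) (lemma (g 0) (g 1))
  where
  lemma : ∀ a b → a ℤ.+ 0ℤ ≡ 1ℤ ℤ.* a ℤ.+ (0ℤ ℤ.- 0ℤ) ℤ.* b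
  lemma = solve-∀
weight-insertions-after g {x} y (y′ ∷ ys) (y<x ∷ y′<x ∷ ys<x) = begin
  g (descents (y ∷ x ∷ y′ ∷ ys)) ℤ.+ weight (λ r → g (descents (y ∷ r))) (map (y′ ∷_) (insertions x ys))
    ≡⟨ cong₂ ℤ._+_
         (cong g (trans (descents-insert-after (y′ ∷ ys) y<x) (descents-insert ys y′<x)))
         (trans (weight-map (λ r → g (descents (y ∷ r))) (y′ ∷_) (insertions x ys))
           -- The comparison of `y` with `y′` is absorbed into the weight, which is why `g` is
           -- arbitrary.
           (weight-insertions-after (λ c → g (jump b ℕ.+ c)) y′ ys (y′<x ∷ ys<x))) ⟩
  g (suc d) ℤ.+ (+ suc d ℤ.* g (jump b ℕ.+ d) ℤ.+ (+ length ys ℤ.- + d) ℤ.* g (jump b ℕ.+ suc d))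
    ≡⟨ collect b ⟩
  + suc (jump b ℕ.+ d) ℤ.* g (jump b ℕ.+ d) ℤ.+ (+ suc (length ys) ℤ.- + (jump b ℕ.+ d)) ℤ.* g (suc (jump b ℕ.+ d)) ∎
  where
  open ≡-Reasoning
  b = does (y′ ℕ.<? y)
  d = descents (y′ ∷ ys)
  jump : Bool → ℕ
  jump b = if b then 1 else 0
  lemma₁ : ∀ d l u v → u ℤ.+ ((1ℤ ℤ.+ d) ℤ.* u ℤ.+ (l ℤ.- d) ℤ.* v)
                       ≡ (+ 2 ℤ.+ d) ℤ.* u ℤ.+ ((1ℤ ℤ.+ l) ℤ.- (1ℤ ℤ.+ d)) ℤ.* v
  lemma₁ = solve-∀
  lemma₂ : ∀ d l u v → v ℤ.+ ((1ℤ ℤ.+ d) ℤ.* u ℤ.+ (l ℤ.- d) ℤ.* v)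
                       ≡ (1ℤ ℤ.+ d) ℤ.* u ℤ.+ ((1ℤ ℤ.+ l) ℤ.- d) ℤ.* v
  lemma₂ = solve-∀
  collect : ∀ b →
    g (suc d) ℤ.+ (+ suc d ℤ.* g (jump b ℕ.+ d) ℤ.+ (+ length ys ℤ.- + d) ℤ.* g (jump b ℕ.+ suc d))
    ≡ + suc (jump b ℕ.+ d) ℤ.* g (jump b ℕ.+ d) ℤ.+ (+ suc (length ys) ℤ.- + (jump b ℕ.+ d)) ℤ.* g (suc (jump b ℕ.+ d))
  collect true  = lemma₁ (+ d) (+ length ys) (g (suc d)) (g (suc (suc d)))
  collect false = lemma₂ (+ d) (+ length ys) (g d) (g (suc d))

weight-insertions : ∀ (g : ℕ → ℤ) {x} π → All (_< x) π → let d = descents π in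
  weight (g ∘ descents) (insertions x π) ≡ + suc d ℤ.* g d ℤ.+ (+ length π ℤ.- + d) ℤ.* g (suc d)
weight-insertions g [] [] = lemma (g 0) (g 1)
  where
  lemma : ∀ a b → a ℤ.+ 0ℤ ≡ 1ℤ ℤ.* a ℤ.+ (0ℤ ℤ.- 0ℤ) ℤ.* b
  lemma = solve-∀
weight-insertions g {x} (y ∷ ys) (y<x ∷ ys<x) = begin
  g (descents (x ∷ y ∷ ys)) ℤ.+ weight (g ∘ descents) (map (y ∷_) (insertions x ys))
    ≡⟨ cong₂ ℤ._+_ (cong g (descents-insert ys y<x))
         (trans (weight-map (g ∘ descents) (y ∷_) (insertions x ys)) (weight-insertions-after g y ys (y<x ∷ ys<x))) ⟩
  g (suc d) ℤ.+ (+ suc d ℤ.* g d ℤ.+ (+ length ys ℤ.- + d) ℤ.* g (suc d))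
    ≡⟨ lemma (+ d) (+ length ys) (g d) (g (suc d)) ⟩
  + suc d ℤ.* g d ℤ.+ (+ suc (length ys) ℤ.- + d) ℤ.* g (suc d) ∎
  where
  open ≡-Reasoning
  d = descents (y ∷ ys)
  lemma : ∀ d l u v → v ℤ.+ ((1ℤ ℤ.+ d) ℤ.* u ℤ.+ (l ℤ.- d) ℤ.* v)
                      ≡ (1ℤ ℤ.+ d) ℤ.* u ℤ.+ ((1ℤ ℤ.+ l) ℤ.- d) ℤ.* v
  lemma = solve-∀

permutations-length : ∀ n {π} → π ∈ permutations n → length π ≡ n
permutations-length n π∈ =
  trans (↭-length (Equivalence.to (∈-permutations n) π∈)) (length-applyDownFrom suc n)

permutations-bounded : ∀ n {π} → π ∈ permutations n → All (_< suc n) π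
permutations-bounded n {π} π∈ = All.tabulate λ i∈ → bound (∈-resp-↭ (Equivalence.to (∈-permutations n) π∈) i∈)
  where
  bound : ∀ {i} → i ∈ applyDownFrom suc n → i < suc n
  bound i∈ with ∈-applyDownFrom⁻ suc i∈
  ... | _ , j<n , refl = s≤s j<n

-- The indicator used by the filter in `A`; `δ (suc k) (suc d)` computes to `δ k d`, so a new
-- descent lowers k by one.
δ : ℕ → ℕ → ℤ
δ k d = monomial k (suc d)

A-weight : ∀ n k → + A n k ≡ weight (δ k ∘ descents) (permutations n)
A-weight n k = length-filter (λ π → suc (descents π) ℕ.≟ k) (permutations n)

-- On the support of the indicator suc d is k. This turns the factors depending on the permutation
-- into constants, ready to leave the sum.
*-δ : ∀ (F : ℕ → ℤ) k d → F (suc d) ℤ.* δ k d ≡ F k ℤ.* δ k d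
*-δ F k d with suc d ℕ.≟ k
... | yes refl = refl
... | no  d≢   = trans (vanish (F (suc d))) (sym (vanish (F k)))
  where
  vanish : ∀ a → a ℤ.* δ k d ≡ 0ℤ
  vanish a = trans (cong (a ℤ.*_) (monomial-≢ d≢)) (ℤ.*-zeroʳ a)

A-zero : ∀ n → + A n 0 ≡ 0ℤ
A-zero n = trans (A-weight n 0) (weight-zero (permutations n) (λ _ → refl))

A-recurrence : ∀ n k → + A (suc n) (suc k) ≡ + suc k ℤ.* + A n (suc k) ℤ.+ (+ suc n ℤ.- + k) ℤ.* + A n k
A-recurrence n k = begin
  + A (suc n) (suc k)
    ≡⟨ A-weight (suc n) (suc k) ⟩
  weight (δ (suc k) ∘ descents) (permutations (suc n))
    ≡⟨ weight-concatMap (δ (suc k) ∘ descents) (insertions (suc n)) (permutations n) ⟩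
  weight (λ π → weight (δ (suc k) ∘ descents) (insertions (suc n) π)) (permutations n)
    ≡⟨ weight-cong (permutations n) insert ⟩
  weight (λ π → + suc k ℤ.* δ (suc k) (descents π) ℤ.+ (+ suc n ℤ.- + k) ℤ.* δ k (descents π)) (permutations n)
    ≡⟨ weight-linear (+ suc k) (+ suc n ℤ.- + k) (δ (suc k) ∘ descents) (δ k ∘ descents) (permutations n) ⟩
  + suc k ℤ.* weight (δ (suc k) ∘ descents) (permutations n) ℤ.+ (+ suc n ℤ.- + k) ℤ.* weight (δ k ∘ descents) (permutations n)
    ≡⟨ cong₂ (λ a b → + suc k ℤ.* a ℤ.+ (+ suc n ℤ.- + k) ℤ.* b) (A-weight n (suc k)) (A-weight n k) ⟨
  + suc k ℤ.* + A n (suc k) ℤ.+ (+ suc n ℤ.- + k) ℤ.* + A n k ∎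
  where
  open ≡-Reasoning
  lemma : ∀ n d → n ℤ.- d ≡ (1ℤ ℤ.+ n) ℤ.- (1ℤ ℤ.+ d)
  lemma = solve-∀
  insert : ∀ {π} → π ∈ permutations n →
    weight (δ (suc k) ∘ descents) (insertions (suc n) π)
    ≡ + suc k ℤ.* δ (suc k) (descents π) ℤ.+ (+ suc n ℤ.- + k) ℤ.* δ k (descents π)
  insert {π} π∈ = begin
    weight (δ (suc k) ∘ descents) (insertions (suc n) π)
      ≡⟨ weight-insertions (δ (suc k)) π (permutations-bounded n π∈) ⟩
    + suc d ℤ.* δ (suc k) d ℤ.+ (+ length π ℤ.- + d) ℤ.* δ k d
      ≡⟨ cong₂ ℤ._+_ (*-δ +_ (suc k) d)
           (trans (cong (λ a → a ℤ.* δ k d) (trans (cong (λ l → + l ℤ.- + d) (permutations-length n π∈)) (lemma (+ n) (+ d))))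
             (*-δ (λ j → + suc n ℤ.- + j) k d)) ⟩
    + suc k ℤ.* δ (suc k) d ℤ.+ (+ suc n ℤ.- + k) ℤ.* δ k d ∎
    where d = descents π

-- Even Eulerian polynomials in the family z^(i+1) q^(2j) (1+z).

E : ℕ → ℤ⟦z⟧
E n k = + A n k

step-zero : ∀ c f → step (ι c) f 0 ≡ 0ℤ
step-zero c f = trans (cong (λ a → 0ℤ ℤ.+ ((a ℤ.* 0ℤ ℤ.+ 0ℤ) ℤ.* f 0 ℤ.+ 0ℤ)) (ι-zero c)) (lemma c (f 0))
  where
  lemma : ∀ c a → 0ℤ ℤ.+ ((c ℤ.* 0ℤ ℤ.+ 0ℤ) ℤ.* a ℤ.+ 0ℤ) ≡ 0ℤ
  lemma = solve-∀

q*-suc : ∀ f n → (q * f) (suc n) ≡ f (suc n) ℤ.- f n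
q*-suc f n = begin
  (q * f) (suc n)                              ≡⟨ *-distribʳ f (ι 1ℤ) (neg z) (suc n) ⟩
  (ι 1ℤ * f) (suc n) ℤ.+ (neg z * f) (suc n)   ≡⟨ cong₂ ℤ._+_ (const-1-* f (suc n)) (*-cong-≗ {g = f} neg≗ (λ _ → refl) (suc n)) ⟩
  f (suc n) ℤ.+ (((ℤ.- 1ℤ) • z) * f) (suc n)   ≡⟨ cong (λ a → f (suc n) ℤ.+ a) (trans (•-* (ℤ.- 1ℤ) z f (suc n)) (cong (ℤ.- 1ℤ ℤ.*_) (z-*-suc f n))) ⟩
  f (suc n) ℤ.+ ℤ.- 1ℤ ℤ.* f n                 ≡⟨ cong (λ a → f (suc n) ℤ.+ a) (ℤ.-1*i≡-i (f n)) ⟩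
  f (suc n) ℤ.- f n                            ∎
  where
  open ≡-Reasoning
  neg≗ : neg z ≗ (ℤ.- 1ℤ) • z
  neg≗ k = sym (ℤ.-1*i≡-i (z k))

step-suc : ∀ c f k → step (ι c) f (suc k) ≡ + suc k ℤ.* f (suc k) ℤ.+ (c ℤ.- + k) ℤ.* f k
step-suc c f k = begin
  (q * θ f) (suc k) ℤ.+ (ι c * z * f) (suc k)
    ≡⟨ cong₂ ℤ._+_ (q*-suc (θ f) k)
         (trans (*-assoc (ι c) z f (suc k)) (trans (ι-* c (z * f) (suc k)) (cong (c ℤ.*_) (z-*-suc f k)))) ⟩
  (+ suc k ℤ.* f (suc k) ℤ.- + k ℤ.* f k) ℤ.+ c ℤ.* f k
    ≡⟨ lemma (+ suc k ℤ.* f (suc k)) (+ k) (f k) c ⟩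
  + suc k ℤ.* f (suc k) ℤ.+ (c ℤ.- + k) ℤ.* f k ∎
  where
  open ≡-Reasoning
  lemma : ∀ a k f c → (a ℤ.- k ℤ.* f) ℤ.+ c ℤ.* f ≡ a ℤ.+ (c ℤ.- k) ℤ.* f
  lemma = solve-∀

E-suc : ∀ n → E (suc n) ≋ step (ι (+ suc n)) (E n) [mod 0 ]
E-suc n = ≗⇒≋ 0 go
  where
  go : E (suc n) ≗ step (ι (+ suc n)) (E n)
  go zero    = trans (A-zero (suc n)) (sym (step-zero (+ suc n) (E n)))
  go (suc k) = trans (A-recurrence n k) (sym (step-suc (+ suc n) (E n) k))

W : ℕ → ℕ → ℤ⟦z⟧
W i j = z ^ᴿ suc i * q ^ᴿ (j ℕ.* 2) * (const 1 + z)

γ : ℕ → ℤ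
γ i = (+ 2 ℤ.* + suc i ℤ.+ 1ℤ) ℤ.* (+ 2 ℤ.* + suc i ℤ.+ + 2)

-- The coefficients of the expansion of the even Eulerian polynomials in
-- the W i j.  The step from level n to n + 1 sends W i j with i + j = n to
-- (i + 1)² W i (j + 1) + γ i W (i + 1) j.

V : ℕ → ℕ → ℤ
V zero    j       = 1ℤ
V (suc i) zero    = γ i ℤ.* V i zero
V (suc i) (suc j) = + suc (suc i) ℤ.* + suc (suc i) ℤ.* V (suc i) j ℤ.+ γ i ℤ.* V i (suc j)

antidiagonal : (ℕ → ℕ → ℤ⟦z⟧) → ℕ → ℤ⟦z⟧
antidiagonal F zero    = F 0 0
antidiagonal F (suc n) = F 0 (suc n) + antidiagonal (F ∘ suc) n

antidiagonal-cong : ∀ {F G} n → (∀ i j → i ℕ.+ j ≡ n → F i j ≋ G i j [mod 0 ]) →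
                    antidiagonal F n ≋ antidiagonal G n [mod 0 ]
antidiagonal-cong zero    F≋G = F≋G 0 0 refl
antidiagonal-cong (suc n) F≋G =
  ≋-+-cong (F≋G 0 (suc n) refl) (antidiagonal-cong n λ i j i+j≡n → F≋G (suc i) j (cong suc i+j≡n))

antidiagonal-step : ∀ c F n → step c (antidiagonal F n) ≋ antidiagonal (λ i j → step c (F i j)) n [mod 0 ]
antidiagonal-step c F zero    = ≋-refl
antidiagonal-step c F (suc n) = ≋-trans (step-+ c (F 0 (suc n)) (antidiagonal (F ∘ suc) n))
  (≋-+-congˡ {x = step c (F 0 (suc n))} (antidiagonal-step c (F ∘ suc) n))

-- An entry of level n + 1 receives `G` from its neighbour with the same i and `H` from the one with
-- i - 1. The row i = 0 has no such second neighbour; `B` stands for it, so that after removing a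
-- row the induction can continue with `H 0` as the boundary.
antidiagonal-suc : ∀ {K G H : ℕ → ℕ → ℤ⟦z⟧} (B : ℕ → ℤ⟦z⟧) n →
  (∀ j → K 0 (suc j) ≋ G 0 j + B (suc j) [mod 0 ]) →
  (∀ i → K (suc i) 0 ≋ H i 0 [mod 0 ]) →
  (∀ i j → K (suc i) (suc j) ≋ G (suc i) j + H i (suc j) [mod 0 ]) →
  antidiagonal K (suc n) ≋ antidiagonal (λ i j → G i j + H i j) n + B (suc n) [mod 0 ]
antidiagonal-suc {K} {G} {H} B zero    K₀ Kˢ₀ Kˢˢ = ≋-trans (≋-+-cong (K₀ 0) (Kˢ₀ 0))
  (≗⇒≋ 0 λ k → lemma (G 0 0 k) (B 1 k) (H 0 0 k))
  where
  lemma : ∀ a b c → a ℤ.+ b ℤ.+ c ≡ a ℤ.+ c ℤ.+ b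
  lemma = solve-∀
antidiagonal-suc {K} {G} {H} B (suc n) K₀ Kˢ₀ Kˢˢ = ≋-trans
  (≋-+-cong (K₀ (suc n))
    (antidiagonal-suc {K ∘ suc} {G ∘ suc} {H ∘ suc} (H 0) n (Kˢˢ 0) (Kˢ₀ ∘ suc) (Kˢˢ ∘ suc)))
  (≗⇒≋ 0 λ k → lemma (G 0 (suc n) k) (B (suc (suc n)) k) (antidiagonal (λ i j → G (suc i) j + H (suc i) j) n k) (H 0 (suc n) k))
  where
  lemma : ∀ a b c d → a ℤ.+ b ℤ.+ (c ℤ.+ d) ≡ a ℤ.+ d ℤ.+ c ℤ.+ b
  lemma = solve-∀

ι-affine : ∀ a b c → ι (+ 2 ℤ.* a ℤ.+ b ℤ.+ c) ≗ ι (+ 2) * ι a + ι b + ι c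
ι-affine a b c k = trans (ι-+-homo (+ 2 ℤ.* a ℤ.+ b) c k) (cong (λ t → t ℤ.+ ι c k)
  (trans (ι-+-homo (+ 2 ℤ.* a) b k) (cong (λ t → t ℤ.+ ι b k) (ι-*-homo (+ 2) a k))))

ι-index : ∀ i j c → + suc (i ℕ.+ j) ℤ.* + 2 ℤ.+ c ≡ + 2 ℤ.* + suc i ℤ.+ + j ℤ.* + 2 ℤ.+ c
ι-index i j = lemma (+ i) (+ j)
  where
  lemma : ∀ i j c → (1ℤ ℤ.+ (i ℤ.+ j)) ℤ.* + 2 ℤ.+ c ≡ + 2 ℤ.* (1ℤ ℤ.+ i) ℤ.+ j ℤ.* + 2 ℤ.+ c
  lemma = solve-∀

-- The constant 2M + N + c of `double-step`, with M = i + 1 and N = 2j, depends only on i + j. One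
-- operator thus serves a whole antidiagonal.
index≋ : ∀ i j c → ι (+ (c ℕ.+ suc (i ℕ.+ j) ℕ.* 2)) ≋ ι (+ 2) * ι (+ suc i) + ι (+ (j ℕ.* 2)) + ι (+ c) [mod 0 ]
index≋ i j c = ≗⇒≋ 0 λ k → trans (cong (λ a → ι a k) eq) (ι-affine (+ suc i) (+ (j ℕ.* 2)) (+ c) k)
  where
  eq : + (c ℕ.+ suc (i ℕ.+ j) ℕ.* 2) ≡ + 2 ℤ.* + suc i ℤ.+ + (j ℕ.* 2) ℤ.+ + c
  eq = trans (cong (λ a → + c ℤ.+ a) (ℤ.pos-* (suc (i ℕ.+ j)) 2)) (trans (ℤ.+-comm (+ c) (+ suc (i ℕ.+ j) ℤ.* + 2))
    (trans (ι-index i j (+ c)) (cong (λ a → + 2 ℤ.* + suc i ℤ.+ a ℤ.+ + c) (sym (ℤ.pos-* j 2)))))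

twice : ℕ → ℤ⟦z⟧ → ℤ⟦z⟧
twice n f = step (ι (+ (2 ℕ.+ suc n ℕ.* 2))) (step (ι (+ (1 ℕ.+ suc n ℕ.* 2))) f)

twice-W : ∀ i j → twice (i ℕ.+ j) (W i j) ≋ ι (+ suc i ℤ.* + suc i) * W i (suc j) + ι (γ i) * W (suc i) j [mod 0 ]
twice-W i j = ≋-trans (step-cong (index≋ i j 2) (step-cong {f = W i j} {W i j} (index≋ i j 1) ≋-refl))
  (≋-trans (double-step (suc i) (j ℕ.* 2))
    (≋-+-cong
      (*-congʳ-≗ {g = W i (suc j)} λ k → sym (ι-*-homo (+ suc i) (+ suc i) k))
      (*-congʳ-≗ {g = W (suc i) j} λ k → sym (trans (ι-*-homo a b k)
        (*-cong-≗ {ι a} {_} {ι b} (affine 1ℤ) (affine (+ 2)) k)))))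
  where
  a = + 2 ℤ.* + suc i ℤ.+ 1ℤ
  b = + 2 ℤ.* + suc i ℤ.+ + 2
  *-congʳ-≗ : ∀ {f f′ g} → f ≗ f′ → f * g ≋ f′ * g [mod 0 ]
  *-congʳ-≗ {g = g} f≗ = ≗⇒≋ 0 (*-cong-≗ {g = g} f≗ (λ _ → refl))
  affine : ∀ c → ι (+ 2 ℤ.* + suc i ℤ.+ c) ≗ ι (+ 2) * ι (+ suc i) + ι c
  affine c k = trans (ι-+-homo (+ 2 ℤ.* + suc i) c k) (cong (λ t → t ℤ.+ ι c k) (ι-*-homo (+ 2) (+ suc i) k))

twice-cong : ∀ n {f g} → f ≋ g [mod 0 ] → twice n f ≋ twice n g [mod 0 ]
twice-cong n f≋g = step-cong {c = ι (+ (2 ℕ.+ suc n ℕ.* 2))} ≋-refl (step-cong {c = ι (+ (1 ℕ.+ suc n ℕ.* 2))} ≋-refl f≋g)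

twice-scale : ∀ n a f → twice n (ι a * f) ≋ ι a * twice n f [mod 0 ]
twice-scale n a f = ≋-trans (step-cong {c = ι c₂} ≋-refl (step-scale (ι c₁) a f)) (step-scale (ι c₂) a (step (ι c₁) f))
  where
  c₁ = + (1 ℕ.+ suc n ℕ.* 2)
  c₂ = + (2 ℕ.+ suc n ℕ.* 2)

E-twice : ∀ n → E (suc (suc n) ℕ.* 2) ≋ twice n (E (suc n ℕ.* 2)) [mod 0 ]
E-twice n = ≋-trans (E-suc (1 ℕ.+ suc n ℕ.* 2))
  (step-cong {c = ι (+ (2 ℕ.+ suc n ℕ.* 2))} ≋-refl (E-suc (suc n ℕ.* 2)))

K : ℕ → ℕ → ℤ⟦z⟧
K i j = ι (V i j) * W i j

E-expansion : ∀ n → E (suc n ℕ.* 2) ≋ antidiagonal K n [mod 0 ]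
E-expansion zero    = ≋-trans (≗⇒≋ 0 E₂) (≋-sym
  (≋-trans (*-identityˡ (W 0 0)) (*-congʳ {const 1 + z} (≋-trans (*-identityʳ (z * const 1)) (*-identityʳ z)))))
  where
  open CommutativeRing (ℤ⟦z⟧/ 0) using (*-identityˡ; *-identityʳ; *-congʳ)
  E₂ : E 2 ≗ z * (const 1 + z)
  E₂ 0                   = refl
  E₂ 1                   = refl
  E₂ 2                   = refl
  E₂ (suc (suc (suc k))) = sym (z-*-suc (const 1 + z) (suc (suc k)))
E-expansion (suc n) = ≋-trans (E-twice n) (≋-trans (twice-cong n (E-expansion n)) (≋-trans
  (step-cong {c = ι (+ (2 ℕ.+ suc n ℕ.* 2))} ≋-refl (antidiagonal-step (ι (+ (1 ℕ.+ suc n ℕ.* 2))) K n))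
  (≋-trans (antidiagonal-step (ι (+ (2 ℕ.+ suc n ℕ.* 2))) (λ i j → step (ι (+ (1 ℕ.+ suc n ℕ.* 2))) (K i j)) n)
  (≋-trans (antidiagonal-cong n twice-K)
  (≋-sym (≋-trans (antidiagonal-suc {K} {G} {H} (λ _ → const 0) n K₀ Kˢ₀ Kˢˢ)
    (CommutativeRing.+-identityʳ (ℤ⟦z⟧/ 0) _)))))))
  where
  G H : ℕ → ℕ → ℤ⟦z⟧
  G i j = ι (V i j) * (ι (+ suc i ℤ.* + suc i) * W i (suc j))
  H i j = ι (V i j) * (ι (γ i) * W (suc i) j)

  twice-K : ∀ i j → i ℕ.+ j ≡ n → twice n (K i j) ≋ G i j + H i j [mod 0 ]
  twice-K i j refl = ≋-trans (twice-scale (i ℕ.+ j) (V i j) (W i j))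
    (≋-trans (≋-*-congˡ {x = ι (V i j)} (twice-W i j))
      (CommutativeRing.distribˡ (ℤ⟦z⟧/ 0) (ι (V i j)) (ι (+ suc i ℤ.* + suc i) * W i (suc j)) (ι (γ i) * W (suc i) j)))

  ι*ι* : ∀ a b f k → (ι a * (ι b * f)) k ≡ a ℤ.* (b ℤ.* f k)
  ι*ι* a b f k = trans (ι-* a (ι b * f) k) (cong (a ℤ.*_) (ι-* b f k))

  K₀ : ∀ j → K 0 (suc j) ≋ G 0 j + const 0 [mod 0 ]
  K₀ j = ≗⇒≋ 0 λ k → trans (ι-* 1ℤ w k) (sym (trans (cong₂ ℤ._+_ (ι*ι* 1ℤ 1ℤ w k) (const-0 k)) (lemma (w k))))
    where
    w = W 0 (suc j)
    lemma : ∀ a → 1ℤ ℤ.* (1ℤ ℤ.* a) ℤ.+ 0ℤ ≡ 1ℤ ℤ.* a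
    lemma = solve-∀

  Kˢ₀ : ∀ i → K (suc i) 0 ≋ H i 0 [mod 0 ]
  Kˢ₀ i = ≗⇒≋ 0 λ k → trans (ι-* (γ i ℤ.* V i 0) w k) (trans (lemma (γ i) (V i 0) (w k)) (sym (ι*ι* (V i 0) (γ i) w k)))
    where
    w = W (suc i) 0
    lemma : ∀ a b c → a ℤ.* b ℤ.* c ≡ b ℤ.* (a ℤ.* c)
    lemma = solve-∀

  Kˢˢ : ∀ i j → K (suc i) (suc j) ≋ G (suc i) j + H i (suc j) [mod 0 ]
  Kˢˢ i j = ≗⇒≋ 0 λ k → trans (ι-* (V (suc i) (suc j)) w k)
    (trans (lemma (+ suc (suc i) ℤ.* + suc (suc i)) (V (suc i) j) (γ i) (V i (suc j)) (w k))
      (sym (cong₂ ℤ._+_ (ι*ι* (V (suc i) j) (+ suc (suc i) ℤ.* + suc (suc i)) w k) (ι*ι* (V i (suc j)) (γ i) w k))))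
    where
    w = W (suc i) (suc j)
    lemma : ∀ a b c d f → (a ℤ.* b ℤ.+ c ℤ.* d) ℤ.* f ≡ b ℤ.* (a ℤ.* f) ℤ.+ d ℤ.* (c ℤ.* f)
    lemma = solve-∀

z^-*-+ : ∀ k f n → (z ^ᴿ k * f) (k ℕ.+ n) ≡ f n
z^-*-+ zero    f n = const-1-* f n
z^-*-+ (suc k) f n = trans (*-assoc z (z ^ᴿ k) f (suc (k ℕ.+ n)))
  (trans (z-*-suc (z ^ᴿ k * f) (k ℕ.+ n)) (z^-*-+ k f n))

-- Removing z^(i+1) leaves degree j + 1 in q^(2j) (1+z), whatever i is; this is the definition of
-- `e j`.
W-coefficient : ∀ i j → W i j (suc (suc (i ℕ.+ j))) ≡ e j
W-coefficient i j = trans (*-assoc (z ^ᴿ suc i) (q ^ᴿ (j ℕ.* 2)) (const 1 + z) (suc (suc (i ℕ.+ j))))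
  (trans (cong (z ^ᴿ suc i * (q ^ᴿ (j ℕ.* 2) * (const 1 + z))) (cong suc (sym (ℕ.+-suc i j))))
    (z^-*-+ (suc i) (q ^ᴿ (j ℕ.* 2) * (const 1 + z)) (suc j)))

-- The generating function of the central coefficients, and its rows modulo 27.

diagonal : (ℕ → ℕ → ℤ) → ℤ⟦z⟧
diagonal c zero    = c 0 0
diagonal c (suc n) = c 0 (suc n) ℤ.+ diagonal (c ∘ suc) n

diagonal-unfold : ∀ c → diagonal c ≗ c 0 + z * diagonal (c ∘ suc)
diagonal-unfold c zero    = sym (ℤ.+-identityʳ (c 0 0))
diagonal-unfold c (suc n) = cong (λ t → c 0 (suc n) ℤ.+ t) (sym (z-*-suc (diagonal (c ∘ suc)) n))

antidiagonal-coefficient : ∀ F c k n → (∀ i j → i ℕ.+ j ≡ n → F i j k ≡ c i j) → antidiagonal F n k ≡ diagonal c n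
antidiagonal-coefficient F c k zero    F≡c = F≡c 0 0 refl
antidiagonal-coefficient F c k (suc n) F≡c =
  cong₂ ℤ._+_ (F≡c 0 (suc n) refl) (antidiagonal-coefficient (F ∘ suc) (c ∘ suc) k n λ i j i+j≡n → F≡c (suc i) j (cong suc i+j≡n))

diagonal-divisible : ∀ {m} c → (∀ i j → m Signed.∣ c i j) → ∀ n → m Signed.∣ diagonal c n
diagonal-divisible c d zero    = d 0 0
diagonal-divisible c d (suc n) = Signed.∣m∣n⇒∣m+n (d 0 (suc n)) (diagonal-divisible (c ∘ suc) (d ∘ suc) n)

A-diagonal : ∀ n → + A (suc n ℕ.* 2) (suc (suc n)) ≡ diagonal (λ i j → V i j ℤ.* e j) n
A-diagonal n = trans (≋0⇒≗ (E-expansion n) (suc (suc n)))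
  (antidiagonal-coefficient K (λ i j → V i j ℤ.* e j) (suc (suc n)) n coefficient)
  where
  coefficient : ∀ i j → i ℕ.+ j ≡ n → K i j (suc (suc n)) ≡ V i j ℤ.* e j
  coefficient i j refl = trans (ι-* (V i j) (W i j) (suc (suc (i ℕ.+ j)))) (cong (V i j ℤ.*_) (W-coefficient i j))

-- The residues of V 1 j, V 2 j and V 3 j modulo 27 as polynomials in
-- j + 1; V 0 j is 1, and V i j vanishes modulo 27 for i ≥ 4.

p₁ p₂ p₃ : ℤ → ℤ
p₁ n = + 18 ℤ.* n ℤ.* n ℤ.- + 6 ℤ.* n
p₂ n = + 9 ℤ.* n
p₃ n = + 9 ℤ.* n ℤ.* n ℤ.+ + 9 ℤ.* n

V-zero-mod : ∀ {i} u v → + 27 Signed.∣ V i 0 ℤ.- u → + 27 Signed.∣ γ i ℤ.* u ℤ.- v → + 27 Signed.∣ V (suc i) 0 ℤ.- v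
V-zero-mod {i} u v d₁ d₂ = subst (+ 27 Signed.∣_) (lemma (γ i) (V i 0) u v)
  (Signed.∣m∣n⇒∣m+n (Signed.∣n⇒∣m*n (γ i) d₁) d₂)
  where
  lemma : ∀ g a u v → g ℤ.* (a ℤ.- u) ℤ.+ (g ℤ.* u ℤ.- v) ≡ g ℤ.* a ℤ.- v
  lemma = solve-∀

V-suc-mod : ∀ {i j} t u v → + 27 Signed.∣ V (suc i) j ℤ.- t → + 27 Signed.∣ V i (suc j) ℤ.- u →
            + 27 Signed.∣ (+ suc (suc i) ℤ.* + suc (suc i) ℤ.* t ℤ.+ γ i ℤ.* u) ℤ.- v →
            + 27 Signed.∣ V (suc i) (suc j) ℤ.- v
V-suc-mod {i} {j} t u v d₁ d₂ d₃ = subst (+ 27 Signed.∣_) (lemma s (γ i) (V (suc i) j) (V i (suc j)) t u v)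
  (Signed.∣m∣n⇒∣m+n (Signed.∣m∣n⇒∣m+n (Signed.∣n⇒∣m*n s d₁) (Signed.∣n⇒∣m*n (γ i) d₂)) d₃)
  where
  s = + suc (suc i) ℤ.* + suc (suc i)
  lemma : ∀ s g a b t u v → s ℤ.* (a ℤ.- t) ℤ.+ g ℤ.* (b ℤ.- u) ℤ.+ ((s ℤ.* t ℤ.+ g ℤ.* u) ℤ.- v)
                            ≡ (s ℤ.* a ℤ.+ g ℤ.* b) ℤ.- v
  lemma = solve-∀

-- With n = j + 1, V 1 j = 4(4ⁿ - 1), and modulo 27 (1+3)ⁿ is 1 + 3n + 9n(n-1)/2.
V₁-mod : ∀ j → + 27 Signed.∣ V 1 j ℤ.- p₁ (+ suc j)
V₁-mod zero    = divides 0ℤ refl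
V₁-mod (suc j) = V-suc-mod {0} {j} (p₁ (+ suc j)) 1ℤ (p₁ (+ suc (suc j))) (V₁-mod j) (divides 0ℤ refl)
  (divides (+ 2 ℤ.* ((1ℤ ℤ.+ + j) ℤ.* (1ℤ ℤ.+ + j) ℤ.- (1ℤ ℤ.+ + j))) (lemma (+ j)))
  where
  lemma : ∀ j → (+ 4 ℤ.* (+ 18 ℤ.* (1ℤ ℤ.+ j) ℤ.* (1ℤ ℤ.+ j) ℤ.- + 6 ℤ.* (1ℤ ℤ.+ j)) ℤ.+ + 12 ℤ.* 1ℤ)
                  ℤ.- (+ 18 ℤ.* (+ 2 ℤ.+ j) ℤ.* (+ 2 ℤ.+ j) ℤ.- + 6 ℤ.* (+ 2 ℤ.+ j))
                ≡ + 2 ℤ.* ((1ℤ ℤ.+ j) ℤ.* (1ℤ ℤ.+ j) ℤ.- (1ℤ ℤ.+ j)) ℤ.* + 27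
  lemma = solve-∀

-- V 2 j = 360 h_j(1, 4, 9), with 360 ≡ 9 modulo 27 and h_j(1, 1, 0) = j + 1 modulo 3.
V₂-mod : ∀ j → + 27 Signed.∣ V 2 j ℤ.- p₂ (+ suc j)
V₂-mod zero    = V-zero-mod {1} (+ 12) (+ 9) (V₁-mod 0) (divides (+ 13) refl)
V₂-mod (suc j) = V-suc-mod {1} {j} (p₂ (+ suc j)) (p₁ (+ suc (suc j))) (p₂ (+ suc (suc j))) (V₂-mod j) (V₁-mod (suc j))
  (divides ((+ 20 ℤ.* (+ 2 ℤ.+ + j) ℤ.* (+ 2 ℤ.+ + j) ℤ.- + 4 ℤ.* (1ℤ ℤ.+ + j) ℤ.- + 7)) (lemma (+ j)))
  where
  lemma : ∀ j → (+ 9 ℤ.* (+ 9 ℤ.* (1ℤ ℤ.+ j)) ℤ.+ + 30 ℤ.* (+ 18 ℤ.* (+ 2 ℤ.+ j) ℤ.* (+ 2 ℤ.+ j) ℤ.- + 6 ℤ.* (+ 2 ℤ.+ j)))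
                  ℤ.- + 9 ℤ.* (+ 2 ℤ.+ j)
                ≡ (+ 20 ℤ.* (+ 2 ℤ.+ j) ℤ.* (+ 2 ℤ.+ j) ℤ.- + 4 ℤ.* (1ℤ ℤ.+ j) ℤ.- + 7) ℤ.* + 27
  lemma = solve-∀

-- V 3 j = 20160 h_j(1, 4, 9, 16), with 20160 ≡ 18 modulo 27 and h_j(1, 1, 0, 1) = (j+1)(j+2)/2
-- modulo 3.
V₃-mod : ∀ j → + 27 Signed.∣ V 3 j ℤ.- p₃ (+ suc j)
V₃-mod zero    = V-zero-mod {2} (+ 9) (+ 18) (V₂-mod 0) (divides (+ 18) refl)
V₃-mod (suc j) = V-suc-mod {2} {j} (p₃ (+ suc j)) (p₂ (+ suc (suc j))) (p₃ (+ suc (suc j))) (V₃-mod j) (V₂-mod (suc j))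
  (divides ((+ 5 ℤ.* (1ℤ ℤ.+ + j) ℤ.* (1ℤ ℤ.+ + j) ℤ.+ + 23 ℤ.* (1ℤ ℤ.+ + j) ℤ.+ + 18)) (lemma (+ j)))
  where
  lemma : ∀ j → (+ 16 ℤ.* (+ 9 ℤ.* (1ℤ ℤ.+ j) ℤ.* (1ℤ ℤ.+ j) ℤ.+ + 9 ℤ.* (1ℤ ℤ.+ j)) ℤ.+ + 56 ℤ.* (+ 9 ℤ.* (+ 2 ℤ.+ j)))
                  ℤ.- (+ 9 ℤ.* (+ 2 ℤ.+ j) ℤ.* (+ 2 ℤ.+ j) ℤ.+ + 9 ℤ.* (+ 2 ℤ.+ j))
                ≡ (+ 5 ℤ.* (1ℤ ℤ.+ j) ℤ.* (1ℤ ℤ.+ j) ℤ.+ + 23 ℤ.* (1ℤ ℤ.+ j) ℤ.+ + 18) ℤ.* + 27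
  lemma = solve-∀

-- The row i = 3 is divisible by 9 and γ 3 = 9 · 10 supplies more than the missing 3; later rows
-- inherit the divisibility through the recurrence.
V₄₊-mod : ∀ i j → + 27 Signed.∣ V (4 ℕ.+ i) j ℤ.- 0ℤ
V₄₊-mod zero    zero    = V-zero-mod {3} (+ 18) 0ℤ (V₃-mod 0) (divides (+ 60) refl)
V₄₊-mod zero    (suc j) = V-suc-mod {3} {j} 0ℤ (p₃ (+ suc (suc j))) 0ℤ (V₄₊-mod zero j) (V₃-mod (suc j))
  (divides (+ 30 ℤ.* (+ suc (suc j) ℤ.* + suc (suc j) ℤ.+ + suc (suc j))) (lemma (+ suc (suc j))))
  where
  lemma : ∀ n → (+ 25 ℤ.* 0ℤ ℤ.+ + 90 ℤ.* (+ 9 ℤ.* n ℤ.* n ℤ.+ + 9 ℤ.* n)) ℤ.- 0ℤ ≡ + 30 ℤ.* (n ℤ.* n ℤ.+ n) ℤ.* + 27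
  lemma = solve-∀
V₄₊-mod (suc i) zero    = V-zero-mod {4 ℕ.+ i} 0ℤ 0ℤ (V₄₊-mod i 0) (divides 0ℤ (lemma (γ (4 ℕ.+ i))))
  where
  lemma : ∀ g → g ℤ.* 0ℤ ℤ.- 0ℤ ≡ 0ℤ ℤ.* + 27
  lemma = solve-∀
V₄₊-mod (suc i) (suc j) = V-suc-mod {4 ℕ.+ i} {j} 0ℤ 0ℤ 0ℤ (V₄₊-mod (suc i) j) (V₄₊-mod i (suc j))
  (divides 0ℤ (lemma (+ suc (suc (4 ℕ.+ i)) ℤ.* + suc (suc (4 ℕ.+ i))) (γ (4 ℕ.+ i))))
  where
  lemma : ∀ s g → (s ℤ.* 0ℤ ℤ.+ g ℤ.* 0ℤ) ℤ.- 0ℤ ≡ 0ℤ ℤ.* + 27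
  lemma = solve-∀

-- Assembly of the rows from h, θh and θ²h.

z-*-diagonal : ∀ c {u t} → z * c 0 ≋ u [mod 27 ] → z * diagonal (c ∘ suc) ≋ t [mod 27 ] → z * diagonal c ≋ u + z * t [mod 27 ]
z-*-diagonal c {u} {t} zc₀≋u zd≋t =
  ≋-trans (≋-*-congˡ {x = z} (≗⇒≋ 27 (diagonal-unfold c)))
    (≋-trans (CommutativeRing.distribˡ (ℤ⟦z⟧/ 27) z (c 0) (z * diagonal (c ∘ suc)))
      (≋-+-cong zc₀≋u (≋-*-congˡ {x = z} zd≋t)))

z-*-e : ∀ (p : ℤ → ℤ) (v : ℕ → ℤ) u → (∀ j → + 27 Signed.∣ v j ℤ.- p (+ suc j)) →
        u 0 ≡ 0ℤ → (∀ j → u (suc j) ≡ p (+ suc j) ℤ.* e j) →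
        z * (λ j → v j ℤ.* e j) ≋ u [mod 27 ]
z-*-e p v u v≡p u₀ uₛ = coefficientwise go
  where
  go : ∀ n → + 27 Signed.∣ (z * (λ j → v j ℤ.* e j)) n ℤ.- u n
  go zero    = divides 0ℤ (cong (λ a → 0ℤ ℤ.- a) u₀)
  go (suc j) = subst (+ 27 Signed.∣_)
    (trans (lemma (v j) (p (+ suc j)) (e j)) (sym (cong₂ ℤ._-_ (z-*-suc (λ j → v j ℤ.* e j) j) (uₛ j))))
    (Signed.∣m⇒∣m*n (e j) (v≡p j))
    where
    lemma : ∀ a b c → (a ℤ.- b) ℤ.* c ≡ a ℤ.* c ℤ.- b ℤ.* c
    lemma = solve-∀

-- Since `h` carries `e j` in degree j + 1, multiplying `e j` by a polynomial in j + 1 amounts to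
-- applying that polynomial in θ to `h`; these series are p₁(θ)h, p₂(θ)h and p₃(θ)h.
u₁ u₂ u₃ : ℤ⟦z⟧
u₁ = ι (+ 12) * θ h + ι (+ 18) * (θ (θ h) + neg θ h)
u₂ = ι (+ 9) * θ h
u₃ = ι (+ 9) * (θ (θ h) + θ h)

-- The leading z shifts each row of `e` onto `h`; peeling rows one at a time gives the nested form,
-- which ends after the row i = 3.
z-*-diagonal-V : z * diagonal (λ i j → V i j ℤ.* e j) ≋ h + z * (u₁ + z * (u₂ + z * u₃)) [mod 27 ]
z-*-diagonal-V =
  z-*-diagonal c (z-*-e (λ _ → 1ℤ) (V 0) h (λ _ → divides 0ℤ refl) refl (λ j → sym (ℤ.*-identityˡ (e j))))
  (z-*-diagonal (c ∘ (1 ℕ.+_)) (z-*-e p₁ (V 1) u₁ V₁-mod refl u₁-suc)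
  (z-*-diagonal (c ∘ (2 ℕ.+_)) (z-*-e p₂ (V 2) u₂ V₂-mod refl u₂-suc)
  (≋-trans (z-*-diagonal (c ∘ (3 ℕ.+_)) {u₃} {const 0} (z-*-e p₃ (V 3) u₃ V₃-mod refl u₃-suc) rest)
    (≋-trans (≋-+-congˡ {x = u₃} (zeroʳ z)) (+-identityʳ u₃)))))
  where
  open CommutativeRing (ℤ⟦z⟧/ 27) using (zeroʳ; +-identityʳ)

  c : ℕ → ℕ → ℤ
  c i j = V i j ℤ.* e j

  u₁-suc : ∀ j → u₁ (suc j) ≡ p₁ (+ suc j) ℤ.* e j
  u₁-suc j = trans (cong₂ ℤ._+_ (ι-* (+ 12) (θ h) (suc j)) (ι-* (+ 18) (θ (θ h) + neg θ h) (suc j))) (lemma (+ suc j) (e j))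
    where
    lemma : ∀ n e → + 12 ℤ.* (n ℤ.* e) ℤ.+ + 18 ℤ.* (n ℤ.* (n ℤ.* e) ℤ.+ ℤ.- (n ℤ.* e))
                    ≡ (+ 18 ℤ.* n ℤ.* n ℤ.- + 6 ℤ.* n) ℤ.* e
    lemma = solve-∀

  u₂-suc : ∀ j → u₂ (suc j) ≡ p₂ (+ suc j) ℤ.* e j
  u₂-suc j = trans (ι-* (+ 9) (θ h) (suc j)) (sym (ℤ.*-assoc (+ 9) (+ suc j) (e j)))

  u₃-suc : ∀ j → u₃ (suc j) ≡ p₃ (+ suc j) ℤ.* e j
  u₃-suc j = trans (ι-* (+ 9) (θ (θ h) + θ h) (suc j)) (lemma (+ suc j) (e j))
    where
    lemma : ∀ n e → + 9 ℤ.* (n ℤ.* (n ℤ.* e) ℤ.+ n ℤ.* e) ≡ (+ 9 ℤ.* n ℤ.* n ℤ.+ + 9 ℤ.* n) ℤ.* e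
    lemma = solve-∀

  rest : z * diagonal (c ∘ (4 ℕ.+_)) ≋ const 0 [mod 27 ]
  rest = coefficientwise λ n → subst (+ 27 Signed.∣_)
    (sym (trans (cong (λ a → (z * diagonal (c ∘ (4 ℕ.+_))) n ℤ.- a) (const-0 n)) (ℤ.+-identityʳ _)))
    (∣-*-coefficient z n λ {k} _ → diagonal-divisible (c ∘ (4 ℕ.+_))
      (λ i j → Signed.∣m⇒∣m*n (e j) (subst (+ 27 Signed.∣_) (ℤ.+-identityʳ (V (4 ℕ.+ i) j)) (V₄₊-mod i j))) k)

central-eulerian : (λ n → + A (2 ℕ.* n) (n ℕ.+ 1)) ≗ const 1 + z * diagonal (λ i j → V i j ℤ.* e j)
central-eulerian zero    = refl
central-eulerian (suc n) = trans (cong₂ (λ a b → + A a b) (ℕ.*-comm 2 (suc n)) (ℕ.+-comm (suc n) 1))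
  (trans (A-diagonal n) (sym (trans (ℤ.+-identityˡ _) (z-*-suc (diagonal (λ i j → V i j ℤ.* e j)) n))))

central-eulerian-mod27 :
  (λ n → + A (2 ℕ.* n) (n ℕ.+ 1))
    ≋ const 14
      + const 3 * (const 3 * z ^ 2 + neg (const 4 * z) + const 2) * Ψ
      + (const 21 * z ^ 3 + const 20 * z ^ 2 + const 13 * z + const 23) * Ψ ^ 3
      + const 3 * (const 6 * z ^ 4 + const 4 * z ^ 3 + const 3 * z ^ 2 + const 4) * Ψ ^ 5 [mod 27 ]
central-eulerian-mod27 =
  ≋-trans (≗⇒≋ 27 central-eulerian) (≋-trans (≋-+-congˡ {x = const 1} z-*-diagonal-V)
    (sqrt-expansion {z} {h} {θ h} {θ (θ h)} {Ψ} {proj₁ r} (≋0⇒≋ h+h²≋z) (≋0⇒≋ (D*θh h h+h²≋z)) (≋0⇒≋ (D*θθh h h+h²≋z)) (≋0⇒≋ (proj₂ r))))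
  where
  open Modulo.Modulo27 27 (ι-m≋0 27) using (sqrt-expansion)
  r = quotient-series Ψ-inverts-D

theorem18p7 : (λ n → + A (2 ℕ.* n) (n ℕ.+ 1))
    ≡ const 14
    + const 3 * (const 3 * z ^ 2 - const 4 * z + const 2) * Ψ
    + (const 21 * z ^ 3 + const 20 * z ^ 2 + const 13 * z + const 23) * Ψ ^ 3
    + const 3 * (const 6 * z ^ 4 + const 4 * z ^ 3 + const 3 * z ^ 2 + const 4) * Ψ ^ 5
    [mod 27 ]
theorem18p7 n = Signed.∣⇒∣ᵤ (at central-eulerian-mod27 n)
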